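{- Let $c_{0,n}$ denote the number of closed closures of size $n$. There exist positive real numbers $\overline{\rho} < \underline{\rho}$ satisfying $\overline{\rho} < \underline{\rho} < \rho_{L_\infty}$ and functions $\theta(n), \kappa(n)$ satisfying $$\limsup_{n\to\infty} \theta(n)^{1/n} = \limsup_{n\to\infty} \kappa(n)^{1/n} = 1$$ such that for all sufficiently large $n$ we have $$\underline{\rho}^{ -n}\,\theta(n) < c_{0,n} < \overline{\rho}^{ -n}\,\kappa(n).$$
   Context: $\lambda$-terms (in de Bruijn notation) are given by the grammar $M ::= \underline{n} \mid \lambda M \mid M\,M$, where $\underline{n}$ ($n \ge 0$) is a de Bruijn index. The (natural) size of a $\lambda$-term is defined by $|\underline{n}| = n+1$, $|\lambda M| = |M|+1$, $|M\,N| = |M|+|N|+1$. For $m \ge 0$, a $\lambda$-term $M$ is $m$-open if prefixing it with $m$ abstractions gives a closed term; equivalently, every occurrence of an index $\underline{n}$ in $M$ lying under exactly $k$ abstractions of $M$ satisfies $n < m+k$. Every $m$-open term is also $(m+1)$-open; $0$-open terms are the closed terms. A closure is a pair $\langle M, e\rangle$ consisting of a $\lambda$-term $M$ and an environment $e$, where an environment is a finite (possibly empty) list of closures. A closure $\langle M, e\rangle$ is $m$-open (defined inductively) if there exists $p \ge 0$ such that $M$ is an $(m+p)$-open $\lambda$-term and $e$ is a list of length $p$ consisting of $m$-open closures. A closure is closed if it is $0$-open. The size of a closure $\langle M, e\rangle$ is $|M| + |e|$, where the size $|e|$ of an environment is the sum of the sizes of its closures (the empty environment has size $0$). The constant $\rho_{L_\infty}$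 is the dominant singularity (radius of convergence) of the generating function $L_\infty(z) = \sum_{n\ge 0} l_n z^n$, where $l_n$ is the number of all $\lambda$-terms (not necessarily closed) of size $n$; explicitly $$\rho_{L_\infty} = \frac{1}{3}\left(\sqrt[3]{26+6\sqrt{33}} - \frac{4\cdot 2^{2/3}}{\sqrt[3]{13+3\sqrt{33}}} - 1\right) \approx 0.29559.$$ -}

module Defs where

open import Data.Integer.Base using (+_)
open import Data.List.Base
  using (List; []; _∷_; _++_; [_]; length; map; upTo; filter; deduplicate;
         cartesianProductWith)
open import Data.List.Membership.Propositional using (_∈_)
open import Data.List.Membership.Propositional.Properties
  using (∈-map⁺; ∈-upTo⁺; ∈-++⁺ˡ; ∈-++⁺ʳ; ∈-cartesianProductWith⁺; ∈-filter⁺;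
         ∈-filter⁻; ∈-deduplicate⁺; ∈-deduplicate⁻)
open import Data.List.Relation.Unary.All using (All; []; _∷_)
open import Data.List.Relation.Unary.Any using (here; there)
open import Data.List.Relation.Unary.Unique.Propositional using (Unique)
open import Data.List.Relation.Unary.Unique.DecPropositional.Properties
  using (deduplicate-!)
open import Data.Nat.Base as ℕ using (ℕ; zero; suc; s≤s)
import Data.Nat.Properties as ℕ
open import Data.Product.Base using (Σ; ∃; ∃-syntax; _×_; _,_; proj₁; proj₂)
open import Data.Rational.Base as ℚ using (ℚ; 0ℚ; 1ℚ; ½)
import Data.Rational.Properties as ℚ
open import Data.Rational.Solver using (module +-*-Solver)
open import Function.Bundles using (_⇔_; mk⇔)
open import Relation.Binary.Definitions using (DecidableEquality)
open import Relation.Binary.PropositionalEquality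
  using (_≡_; refl; sym; trans; cong; cong₂; subst;
         module ≡-Reasoning)
open import Relation.Nullary using (¬_; Dec; yes; no)
open import Relation.Nullary.Decidable using (_×-dec_; map′)
open import Relation.Unary using (Decidable)

data Term : Set where
  var : ℕ → Term
  lam : Term → Term
  app : Term → Term → Term

∣_∣ₜ : Term → ℕ
∣ var n ∣ₜ   = n ℕ.+ 1
∣ lam M ∣ₜ   = ∣ M ∣ₜ ℕ.+ 1
∣ app M N ∣ₜ = ∣ M ∣ₜ ℕ.+ ∣ N ∣ₜ ℕ.+ 1

-- OpenTerm m M: an index of M lying under k abstractions is < m + k.
data OpenTerm (m : ℕ) : Term → Set where
  var : ∀ {n} → n ℕ.< m → OpenTerm m (var n)
  lam : ∀ {M} → OpenTerm (suc m) M → OpenTerm m (lam M)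
  app : ∀ {M N} → OpenTerm m M → OpenTerm m N → OpenTerm m (app M N)

data Closure : Set where
  ⟨_,_⟩ : Term → List Closure → Closure

Env : Set
Env = List Closure

mutual
  ∣_∣ᶜ : Closure → ℕ
  ∣ ⟨ M , e ⟩ ∣ᶜ = ∣ M ∣ₜ ℕ.+ ∣ e ∣ᵉ

  ∣_∣ᵉ : Env → ℕ
  ∣ [] ∣ᵉ    = 0
  ∣ C ∷ e ∣ᵉ = ∣ C ∣ᶜ ℕ.+ ∣ e ∣ᵉ

data OpenClosure (m : ℕ) : Closure → Set where
  closure : ∀ {M e} (p : ℕ) → OpenTerm (m ℕ.+ p) M →
            length e ≡ p → All (OpenClosure m) e → OpenClosure m ⟨ M , e ⟩

-- An exhaustive duplicate-free list of the x with P x; its length does not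
-- depend on the choice of list.
record Finite {A : Set} (P : A → Set) : Set where
  field
    elements   : List A
    unique     : Unique elements
    ∈-elements : ∀ x → x ∈ elements ⇔ P x

card : {A : Set} {P : A → Set} → Finite P → ℕ
card F = length (Finite.elements F)

finite : {A : Set} {P : A → Set} → DecidableEquality A → Decidable P →
         (xs : List A) → (∀ x → P x → x ∈ xs) → Finite P
finite _≟_ P? xs complete = record
  { elements   = deduplicate _≟_ (filter P? xs)
  ; unique     = deduplicate-! _≟_ (filter P? xs)
  ; ∈-elements = λ x → mk⇔
      (λ x∈ → proj₂ (∈-filter⁻ P? {xs = xs}
                (∈-deduplicate⁻ _≟_ (filter P? xs) x∈)))
      (λ px → ∈-deduplicate⁺ _≟_ (∈-filter⁺ P? (complete x px) px))
  }

infix 4 _≟ₜ_ _≟ᶜ_ _≟ᵉ_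

_≟ₜ_ : DecidableEquality Term
var m   ≟ₜ var n    = map′ (cong var) (λ { refl → refl }) (m ℕ.≟ n)
var _   ≟ₜ lam _    = no λ ()
var _   ≟ₜ app _ _  = no λ ()
lam _   ≟ₜ var _    = no λ ()
lam M   ≟ₜ lam N    = map′ (cong lam) (λ { refl → refl }) (M ≟ₜ N)
lam _   ≟ₜ app _ _  = no λ ()
app _ _ ≟ₜ var _    = no λ ()
app _ _ ≟ₜ lam _    = no λ ()
app M N ≟ₜ app M′ N′ =
  map′ (λ { (refl , refl) → refl }) (λ { refl → refl , refl })
       (M ≟ₜ M′ ×-dec N ≟ₜ N′)

mutual
  _≟ᶜ_ : DecidableEquality Closure
  ⟨ M , e ⟩ ≟ᶜ ⟨ M′ , e′ ⟩ =
    map′ (λ { (refl , refl) → refl }) (λ { refl → refl , refl })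
         (M ≟ₜ M′ ×-dec e ≟ᵉ e′)

  _≟ᵉ_ : DecidableEquality Env
  []      ≟ᵉ []        = yes refl
  []      ≟ᵉ (_ ∷ _)   = no λ ()
  (_ ∷ _) ≟ᵉ []        = no λ ()
  (C ∷ e) ≟ᵉ (C′ ∷ e′) =
    map′ (λ { (refl , refl) → refl }) (λ { refl → refl , refl })
         (C ≟ᶜ C′ ×-dec e ≟ᵉ e′)

openTerm? : ∀ m → Decidable (OpenTerm m)
openTerm? m (var n)   = map′ var (λ { (var p) → p }) (n ℕ.<? m)
openTerm? m (lam M)   = map′ lam (λ { (lam p) → p }) (openTerm? (suc m) M)
openTerm? m (app M N) =
  map′ (λ { (p , q) → app p q }) (λ { (app p q) → p , q })
       (openTerm? m M ×-dec openTerm? m N)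

mutual
  openClosure? : ∀ m → Decidable (OpenClosure m)
  openClosure? m ⟨ M , e ⟩ =
    map′ (λ { (o , os) → closure (length e) o refl os })
         (λ { (closure _ o refl os) → o , os })
         (openTerm? (m ℕ.+ length e) M ×-dec openEnv? m e)

  openEnv? : ∀ m → Decidable (All (OpenClosure m))
  openEnv? m []      = yes []
  openEnv? m (C ∷ e) =
    map′ (λ { (o , os) → o ∷ os }) (λ { (o ∷ os) → o , os })
         (openClosure? m C ×-dec openEnv? m e)

-- terms n and closures n contain, among others, everything of size ≤ n;
-- envs n Cs consists of the lists of length ≤ n over Cs.
terms : ℕ → List Term
terms zero    = []
terms (suc n) = map var (upTo (suc n)) ++ map lam (terms n) ++
                cartesianProductWith app (terms n) (terms n)

envs : ℕ → List Closure → List Env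
envs zero    Cs = [ [] ]
envs (suc n) Cs = [] ∷ cartesianProductWith _∷_ Cs (envs n Cs)

closures : ℕ → List Closure
closures zero    = []
closures (suc n) =
  cartesianProductWith ⟨_,_⟩ (terms (suc n)) (envs n (closures n))

private
  +1≤ : ∀ {a n} → a ℕ.+ 1 ℕ.≤ suc n → a ℕ.≤ n
  +1≤ {a} {n} p = ℕ.≤-pred (subst (λ k → k ℕ.≤ suc n) (ℕ.+-comm a 1) p)

  0<∣M∣ : ∀ M → 0 ℕ.< ∣ M ∣ₜ
  0<∣M∣ (var n)   = ℕ.m≤n+m 1 n
  0<∣M∣ (lam M)   = ℕ.m≤n+m 1 ∣ M ∣ₜ
  0<∣M∣ (app M N) = ℕ.m≤n+m 1 (∣ M ∣ₜ ℕ.+ ∣ N ∣ₜ)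

  0<∣C∣ : ∀ C → 0 ℕ.< ∣ C ∣ᶜ
  0<∣C∣ ⟨ M , e ⟩ = ℕ.≤-trans (0<∣M∣ M) (ℕ.m≤m+n ∣ M ∣ₜ ∣ e ∣ᵉ)

  positive-+ : ∀ {a b n} → 0 ℕ.< a → a ℕ.+ b ℕ.≤ suc n → b ℕ.≤ n
  positive-+ {a} {b} 0<a p = ℕ.≤-pred (ℕ.≤-trans (ℕ.+-monoˡ-≤ b 0<a) p)

  ∈-terms : ∀ n M → ∣ M ∣ₜ ℕ.≤ n → M ∈ terms n
  ∈-terms zero M p with () ← ℕ.≤-trans (0<∣M∣ M) p
  ∈-terms (suc n) (var k) p = ∈-++⁺ˡ (∈-map⁺ var (∈-upTo⁺ (s≤s (+1≤ p))))
  ∈-terms (suc n) (lam M) p = ∈-++⁺ʳ (map var (upTo (suc n)))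
    (∈-++⁺ˡ (∈-map⁺ lam (∈-terms n M (+1≤ p))))
  ∈-terms (suc n) (app M N) p = ∈-++⁺ʳ (map var (upTo (suc n)))
    (∈-++⁺ʳ (map lam (terms n)) (∈-cartesianProductWith⁺ app
      (∈-terms n M (ℕ.m+n≤o⇒m≤o ∣ M ∣ₜ (+1≤ p)))
      (∈-terms n N (ℕ.m+n≤o⇒n≤o ∣ M ∣ₜ (+1≤ p)))))

  mutual
    ∈-closures : ∀ n C → ∣ C ∣ᶜ ℕ.≤ n → C ∈ closures n
    ∈-closures zero C p with () ← ℕ.≤-trans (0<∣C∣ C) p
    ∈-closures (suc n) ⟨ M , e ⟩ p = ∈-cartesianProductWith⁺ ⟨_,_⟩
      (∈-terms (suc n) M (ℕ.m+n≤o⇒m≤o ∣ M ∣ₜ p))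
      (∈-envs n n e (positive-+ (0<∣M∣ M) p) (positive-+ (0<∣M∣ M) p))

    ∈-envs : ∀ n k e → ∣ e ∣ᵉ ℕ.≤ n → ∣ e ∣ᵉ ℕ.≤ k → e ∈ envs k (closures n)
    ∈-envs n zero    []      p q = here refl
    ∈-envs n (suc k) []      p q = here refl
    ∈-envs n zero    (C ∷ e) p q
      with () ← ℕ.≤-trans (0<∣C∣ C) (ℕ.m+n≤o⇒m≤o ∣ C ∣ᶜ q)
    ∈-envs n (suc k) (C ∷ e) p q = there (∈-cartesianProductWith⁺ _∷_
      (∈-closures n C (ℕ.m+n≤o⇒m≤o ∣ C ∣ᶜ p))
      (∈-envs n k e (ℕ.m+n≤o⇒n≤o ∣ C ∣ᶜ p) (positive-+ (0<∣C∣ C) q)))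

finiteTerms : ∀ n → Finite (λ M → ∣ M ∣ₜ ≡ n)
finiteTerms n = finite _≟ₜ_ (λ M → ∣ M ∣ₜ ℕ.≟ n) (terms n)
  (λ M p → ∈-terms n M (ℕ.≤-reflexive p))

finiteClosures : ∀ m n → Finite (λ C → OpenClosure m C × ∣ C ∣ᶜ ≡ n)
finiteClosures m n =
  finite _≟ᶜ_ (λ C → openClosure? m C ×-dec (∣ C ∣ᶜ ℕ.≟ n)) (closures n)
    (λ C p → ∈-closures n C (ℕ.≤-reflexive (proj₂ p)))

l : ℕ → ℕ
l n = card (finiteTerms n)

c : ℕ → ℕ → ℕ
c m n = card (finiteClosures m n)

-- Real numbers, as Cauchy sequences of rationals.  Equality is the
-- relation _≃_, not _≡_.

Eventually : (ℕ → Set) → Set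
Eventually P = ∃[ N ] (∀ n → N ℕ.≤ n → P n)

IsCauchy : (ℕ → ℚ) → Set
IsCauchy x = ∀ ε → 0ℚ ℚ.< ε →
  ∃[ N ] (∀ m n → N ℕ.≤ m → N ℕ.≤ n → ℚ.∣ x m ℚ.- x n ∣ ℚ.≤ ε)

record ℝ : Set where
  constructor mkℝ
  field
    seq    : ℕ → ℚ
    cauchy : IsCauchy seq

open ℝ public

infix 4 _≃_ _<_ _≤_

_≃_ : ℝ → ℝ → Set
x ≃ y = ∀ ε → 0ℚ ℚ.< ε → Eventually (λ n → ℚ.∣ seq x n ℚ.- seq y n ∣ ℚ.≤ ε)

_<_ : ℝ → ℝ → Set
x < y = ∃[ ε ] (0ℚ ℚ.< ε × Eventually (λ n → seq x n ℚ.+ ε ℚ.< seq y n))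

_≤_ : ℝ → ℝ → Set
x ≤ y = ¬ (y < x)

private
  module Identities where
    open import Data.Rational.Base using (_+_; _-_; _*_; -_)
    open +-*-Solver

    shift : ∀ a b → a ≡ (a - b) + b
    shift = solve 2 (λ a b → a := (a :- b) :+ b) refl

    cancel : ∀ a b → (a + b) - b ≡ a
    cancel = solve 2 (λ a b → (a :+ b) :- b := a) refl

    flip : ∀ a b → b - a ≡ - (a - b)
    flip = solve 2 (λ a b → b :- a := :- (a :- b)) refl

    diff-neg : ∀ a b → - (a - b) ≡ (- a) - (- b)
    diff-neg = solve 2 (λ a b → :- (a :- b) := (:- a) :- (:- b)) refl

    diff-+ : ∀ a b c d → (a + b) - (c + d) ≡ (a - c) + (b - d)
    diff-+ = solve 4 (λ a b c d →
      (a :+ b) :- (c :+ d) := (a :- c) :+ (b :- d)) refl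

    diff-* : ∀ a b c d → a * b - c * d ≡ a * (b - d) + (a - c) * d
    diff-* = solve 4 (λ a b c d →
      a :* b :- c :* d := a :* (b :- d) :+ (a :- c) :* d) refl

    diff-inv : ∀ i j a b → i * (j * b) - j * (i * a) ≡ (i * j) * (b - a)
    diff-inv = solve 4 (λ i j a b →
      i :* (j :* b) :- j :* (i :* a) := (i :* j) :* (b :- a)) refl

    collect : ∀ a b e i → a * (e * i) + (e * i) * b ≡ e * (i * (a + b))
    collect = solve 4 (λ a b e i →
      a :* (e :* i) :+ (e :* i) :* b := e :* (i :* (a :+ b))) refl

    swap : ∀ i d a → i * (d * a) ≡ d * (i * a)
    swap = solve 3 (λ i d a → i :* (d :* a) := d :* (i :* a)) refl

    squares : ∀ d i e → (i * i) * (e * (d * d)) ≡ e * ((i * d) * (i * d))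
    squares = solve 3 (λ d i e →
      (i :* i) :* (e :* (d :* d)) := e :* ((i :* d) :* (i :* d))) refl

  open Identities

  0<½ε : ∀ {ε} → 0ℚ ℚ.< ε → 0ℚ ℚ.< ε ℚ.* ½
  0<½ε {ε} 0<ε = subst (ℚ._< ε ℚ.* ½) (ℚ.*-zeroˡ ½) (ℚ.*-monoˡ-<-pos ½ 0<ε)

  0<* : ∀ {p q} → 0ℚ ℚ.< p → 0ℚ ℚ.< q → 0ℚ ℚ.< p ℚ.* q
  0<* {p} {q} 0<p 0<q = subst (ℚ._< p ℚ.* q) (ℚ.*-zeroˡ q)
    (ℚ.*-monoˡ-<-pos q {{ℚ.positive 0<q}} 0<p)

  0<1/ : ∀ {p} (0<p : 0ℚ ℚ.< p) → 0ℚ ℚ.< (ℚ.1/ p) {{ℚ.>-nonZero 0<p}}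
  0<1/ {p} 0<p = ℚ.positive⁻¹ _ {{ℚ.1/pos⇒pos p {{ℚ.positive 0<p}}}}

  *-mono : ∀ {p q r s} → 0ℚ ℚ.≤ q → 0ℚ ℚ.≤ r → p ℚ.≤ r → q ℚ.≤ s →
           p ℚ.* q ℚ.≤ r ℚ.* s
  *-mono {p} {q} {r} {s} 0≤q 0≤r p≤r q≤s = ℚ.≤-trans
    (ℚ.*-monoʳ-≤-nonNeg q {{ℚ.nonNegative 0≤q}} p≤r)
    (ℚ.*-monoˡ-≤-nonNeg r {{ℚ.nonNegative 0≤r}} q≤s)

  half+half : ∀ ε → ε ℚ.* ½ ℚ.+ ε ℚ.* ½ ≡ ε
  half+half ε = trans (sym (ℚ.*-distribˡ-+ ε ½ ½)) (ℚ.*-identityʳ ε)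

  bounded : ∀ {x} → IsCauchy x →
            ∃[ B ] (0ℚ ℚ.< B × Eventually (λ n → ℚ.∣ x n ∣ ℚ.≤ B))
  bounded {x} cx with cx 1ℚ (ℚ.positive⁻¹ 1ℚ)
  ... | N , h = 1ℚ ℚ.+ ℚ.∣ x N ∣ , 0<B , N , bound
    where
    open ℚ.≤-Reasoning
    0<B : 0ℚ ℚ.< 1ℚ ℚ.+ ℚ.∣ x N ∣
    0<B = subst (ℚ._< 1ℚ ℚ.+ ℚ.∣ x N ∣) (ℚ.+-identityˡ 0ℚ)
      (ℚ.+-mono-<-≤ (ℚ.positive⁻¹ 1ℚ) (ℚ.0≤∣p∣ (x N)))
    bound : ∀ n → N ℕ.≤ n → ℚ.∣ x n ∣ ℚ.≤ 1ℚ ℚ.+ ℚ.∣ x N ∣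
    bound n N≤n = begin
      ℚ.∣ x n ∣
        ≡⟨ cong ℚ.∣_∣ (shift (x n) (x N)) ⟩
      ℚ.∣ (x n ℚ.- x N) ℚ.+ x N ∣
        ≤⟨ ℚ.∣p+q∣≤∣p∣+∣q∣ (x n ℚ.- x N) (x N) ⟩
      ℚ.∣ x n ℚ.- x N ∣ ℚ.+ ℚ.∣ x N ∣
        ≤⟨ ℚ.+-monoˡ-≤ ℚ.∣ x N ∣ (h n N N≤n ℕ.≤-refl) ⟩
      1ℚ ℚ.+ ℚ.∣ x N ∣ ∎

  const-cauchy : ∀ q → IsCauchy (λ _ → q)
  const-cauchy q ε 0<ε = 0 , λ _ _ _ _ →
    subst (ℚ._≤ ε) (sym (cong ℚ.∣_∣ (ℚ.+-inverseʳ q))) (ℚ.<⇒≤ 0<ε)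

  +-cauchy : ∀ {x y} → IsCauchy x → IsCauchy y → IsCauchy (λ n → x n ℚ.+ y n)
  +-cauchy {x} {y} cx cy ε 0<ε
    with cx (ε ℚ.* ½) (0<½ε 0<ε) | cy (ε ℚ.* ½) (0<½ε 0<ε)
  ... | N , h | N′ , h′ = N ℕ.⊔ N′ , λ m n p q → begin
      ℚ.∣ (x m ℚ.+ y m) ℚ.- (x n ℚ.+ y n) ∣
        ≡⟨ cong ℚ.∣_∣ (diff-+ (x m) (y m) (x n) (y n)) ⟩
      ℚ.∣ (x m ℚ.- x n) ℚ.+ (y m ℚ.- y n) ∣
        ≤⟨ ℚ.∣p+q∣≤∣p∣+∣q∣ (x m ℚ.- x n) (y m ℚ.- y n) ⟩
      ℚ.∣ x m ℚ.- x n ∣ ℚ.+ ℚ.∣ y m ℚ.- y n ∣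
        ≤⟨ ℚ.+-mono-≤
             (h m n (ℕ.m⊔n≤o⇒m≤o N N′ p) (ℕ.m⊔n≤o⇒m≤o N N′ q))
             (h′ m n (ℕ.m⊔n≤o⇒n≤o N N′ p) (ℕ.m⊔n≤o⇒n≤o N N′ q)) ⟩
      ε ℚ.* ½ ℚ.+ ε ℚ.* ½
        ≡⟨ half+half ε ⟩
      ε ∎
      where
      open ℚ.≤-Reasoning

  neg-cauchy : ∀ {x} → IsCauchy x → IsCauchy (λ n → ℚ.- x n)
  neg-cauchy {x} cx ε 0<ε with cx ε 0<ε
  ... | N , h = N , λ m n p q → subst (ℚ._≤ ε)
      (trans (sym (ℚ.∣-p∣≡∣p∣ (x m ℚ.- x n)))
        (cong ℚ.∣_∣ (diff-neg (x m) (x n))))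
      (h m n p q)

  ∣∣-cauchy : ∀ {x} → IsCauchy x → IsCauchy (λ n → ℚ.∣ x n ∣)
  ∣∣-cauchy {x} cx ε 0<ε with cx ε 0<ε
  ... | N , h = N , λ m n p q → ∣∣≤ (one m n p q) (subst (ℚ._≤ ε)
      (flip ℚ.∣ x m ∣ ℚ.∣ x n ∣)
      (one n m q p))
      where
      open import Data.Sum.Base using (inj₁; inj₂)
      ∣∣≤ : ∀ {p r} → p ℚ.≤ r → ℚ.- p ℚ.≤ r → ℚ.∣ p ∣ ℚ.≤ r
      ∣∣≤ {p} {r} p≤r -p≤r with ℚ.∣p∣≡p∨∣p∣≡-p p
      ... | inj₁ eq = subst (ℚ._≤ r) (sym eq) p≤r
      ... | inj₂ eq = subst (ℚ._≤ r) (sym eq) -p≤r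
      one : ∀ m n → N ℕ.≤ m → N ℕ.≤ n → ℚ.∣ x m ∣ ℚ.- ℚ.∣ x n ∣ ℚ.≤ ε
      one m n p q = begin
        ℚ.∣ x m ∣ ℚ.- ℚ.∣ x n ∣
          ≡⟨ cong (λ t → ℚ.∣ t ∣ ℚ.- ℚ.∣ x n ∣)
               (shift (x m) (x n)) ⟩
        ℚ.∣ (x m ℚ.- x n) ℚ.+ x n ∣ ℚ.- ℚ.∣ x n ∣
          ≤⟨ ℚ.+-monoˡ-≤ (ℚ.- ℚ.∣ x n ∣) (ℚ.∣p+q∣≤∣p∣+∣q∣ (x m ℚ.- x n) (x n)) ⟩
        (ℚ.∣ x m ℚ.- x n ∣ ℚ.+ ℚ.∣ x n ∣) ℚ.- ℚ.∣ x n ∣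
          ≡⟨ cancel ℚ.∣ x m ℚ.- x n ∣ ℚ.∣ x n ∣ ⟩
        ℚ.∣ x m ℚ.- x n ∣
          ≤⟨ h m n p q ⟩
        ε ∎
        where open ℚ.≤-Reasoning

  split : ∀ {A B ε} → 0ℚ ℚ.< A → 0ℚ ℚ.< B → 0ℚ ℚ.< ε →
          ∃[ δ ] (0ℚ ℚ.< δ × A ℚ.* δ ℚ.+ δ ℚ.* B ≡ ε)
  split {A} {B} {ε} 0<A 0<B 0<ε =
    ε ℚ.* i , 0<* 0<ε (0<1/ 0<S) ,
    trans (collect A B ε i)
      (trans (cong (ε ℚ.*_) (ℚ.*-inverseˡ (A ℚ.+ B) {{ℚ.>-nonZero 0<S}}))
        (ℚ.*-identityʳ ε))
    where
    0<S : 0ℚ ℚ.< A ℚ.+ B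
    0<S = subst (ℚ._< A ℚ.+ B) (ℚ.+-identityˡ 0ℚ) (ℚ.+-mono-< 0<A 0<B)
    i : ℚ
    i = (ℚ.1/ (A ℚ.+ B)) {{ℚ.>-nonZero 0<S}}

  diff-*-bound : ∀ {A B δ ε} a b c d → A ℚ.* δ ℚ.+ δ ℚ.* B ≡ ε →
    0ℚ ℚ.≤ A → 0ℚ ℚ.≤ δ → ℚ.∣ a ∣ ℚ.≤ A → ℚ.∣ d ∣ ℚ.≤ B →
    ℚ.∣ a ℚ.- c ∣ ℚ.≤ δ → ℚ.∣ b ℚ.- d ∣ ℚ.≤ δ →
    ℚ.∣ a ℚ.* b ℚ.- c ℚ.* d ∣ ℚ.≤ ε
  diff-*-bound {A} {B} {δ} {ε} a b c d eq 0≤A 0≤δ a≤A d≤B a-c b-d = begin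
    ℚ.∣ a ℚ.* b ℚ.- c ℚ.* d ∣
      ≡⟨ cong ℚ.∣_∣ (diff-* a b c d) ⟩
    ℚ.∣ a ℚ.* (b ℚ.- d) ℚ.+ (a ℚ.- c) ℚ.* d ∣
      ≤⟨ ℚ.∣p+q∣≤∣p∣+∣q∣ (a ℚ.* (b ℚ.- d)) ((a ℚ.- c) ℚ.* d) ⟩
    ℚ.∣ a ℚ.* (b ℚ.- d) ∣ ℚ.+ ℚ.∣ (a ℚ.- c) ℚ.* d ∣
      ≡⟨ cong₂ ℚ._+_ (ℚ.∣p*q∣≡∣p∣*∣q∣ a (b ℚ.- d)) (ℚ.∣p*q∣≡∣p∣*∣q∣ (a ℚ.- c) d) ⟩
    ℚ.∣ a ∣ ℚ.* ℚ.∣ b ℚ.- d ∣ ℚ.+ ℚ.∣ a ℚ.- c ∣ ℚ.* ℚ.∣ d ∣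
      ≤⟨ ℚ.+-mono-≤ (*-mono (ℚ.0≤∣p∣ (b ℚ.- d)) 0≤A a≤A b-d)
                    (*-mono (ℚ.0≤∣p∣ d) 0≤δ a-c d≤B) ⟩
    A ℚ.* δ ℚ.+ δ ℚ.* B
      ≡⟨ eq ⟩
    ε ∎
    where open ℚ.≤-Reasoning

  *-cauchy : ∀ {x y} → IsCauchy x → IsCauchy y → IsCauchy (λ n → x n ℚ.* y n)
  *-cauchy {x} {y} cx cy ε 0<ε =
    let A , 0<A , N₁ , hA = bounded {x} cx
        B , 0<B , N₂ , hB = bounded {y} cy
        δ , 0<δ , eq      = split 0<A 0<B 0<ε
        N₃ , hx           = cx δ 0<δ
        N₄ , hy           = cy δ 0<δ
        L = N₁ ℕ.⊔ N₂
        R = N₃ ℕ.⊔ N₄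
    in L ℕ.⊔ R , λ m n p q →
      diff-*-bound (x m) (y m) (x n) (y n) eq (ℚ.<⇒≤ 0<A) (ℚ.<⇒≤ 0<δ)
        (hA m (ℕ.m⊔n≤o⇒m≤o N₁ N₂ (ℕ.m⊔n≤o⇒m≤o L R p)))
        (hB n (ℕ.m⊔n≤o⇒n≤o N₁ N₂ (ℕ.m⊔n≤o⇒m≤o L R q)))
        (hx m n (ℕ.m⊔n≤o⇒m≤o N₃ N₄ (ℕ.m⊔n≤o⇒n≤o L R p))
                (ℕ.m⊔n≤o⇒m≤o N₃ N₄ (ℕ.m⊔n≤o⇒n≤o L R q)))
        (hy m n (ℕ.m⊔n≤o⇒n≤o N₃ N₄ (ℕ.m⊔n≤o⇒n≤o L R p))
                (ℕ.m⊔n≤o⇒n≤o N₃ N₄ (ℕ.m⊔n≤o⇒n≤o L R q)))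

infixl 6 _+_ _-_
infixl 7 _*_
infix  8 -_
infixr 9 _^_

fromℚ : ℚ → ℝ
fromℚ q = mkℝ (λ _ → q) (const-cauchy q)

fromℕ : ℕ → ℝ
fromℕ n = fromℚ (+ n ℚ./ 1)

0ℝ 1ℝ : ℝ
0ℝ = fromℚ 0ℚ
1ℝ = fromℚ 1ℚ

_+_ : ℝ → ℝ → ℝ
x + y = mkℝ (λ n → seq x n ℚ.+ seq y n) (+-cauchy {seq x} {seq y} (cauchy x) (cauchy y))

-_ : ℝ → ℝ
- x = mkℝ (λ n → ℚ.- seq x n) (neg-cauchy {seq x} (cauchy x))

_-_ : ℝ → ℝ → ℝ
x - y = x + (- y)

_*_ : ℝ → ℝ → ℝ
x * y = mkℝ (λ n → seq x n ℚ.* seq y n) (*-cauchy {seq x} {seq y} (cauchy x) (cauchy y))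

∣_∣ : ℝ → ℝ
∣ x ∣ = mkℝ (λ n → ℚ.∣ seq x n ∣) (∣∣-cauchy {seq x} (cauchy x))

_^_ : ℝ → ℕ → ℝ
x ^ zero  = 1ℝ
x ^ suc n = x * x ^ n

private
  recip : (a : ℚ) → 0ℚ ℚ.< a → ∃[ i ] (0ℚ ℚ.≤ i × i ℚ.* a ≡ 1ℚ)
  recip a 0<a = (ℚ.1/ a) {{ℚ.>-nonZero 0<a}} , ℚ.<⇒≤ (0<1/ 0<a) ,
    ℚ.*-inverseˡ a {{ℚ.>-nonZero 0<a}}

  recip-antimono : ∀ {d a i k} → 0ℚ ℚ.≤ i → 0ℚ ℚ.≤ k → d ℚ.≤ a →
                   i ℚ.* a ≡ 1ℚ → k ℚ.* d ≡ 1ℚ → i ℚ.≤ k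
  recip-antimono {d} {a} {i} {k} 0≤i 0≤k d≤a ia kd = begin
    i               ≡⟨ ℚ.*-identityʳ i ⟨
    i ℚ.* 1ℚ        ≡⟨ cong (i ℚ.*_) kd ⟨
    i ℚ.* (k ℚ.* d) ≤⟨ ℚ.*-monoˡ-≤-nonNeg i {{ℚ.nonNegative 0≤i}}
                        (ℚ.*-monoˡ-≤-nonNeg k {{ℚ.nonNegative 0≤k}} d≤a) ⟩
    i ℚ.* (k ℚ.* a) ≡⟨ swap i k a ⟩
    k ℚ.* (i ℚ.* a) ≡⟨ cong (k ℚ.*_) ia ⟩
    k ℚ.* 1ℚ        ≡⟨ ℚ.*-identityʳ k ⟩
    k               ∎
    where open ℚ.≤-Reasoning

  recip-diff : ∀ {i j a b} → i ℚ.* a ≡ 1ℚ → j ℚ.* b ≡ 1ℚ →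
               i ℚ.- j ≡ (i ℚ.* j) ℚ.* (b ℚ.- a)
  recip-diff {i} {j} {a} {b} ia jb = begin
    i ℚ.- j                             ≡⟨ cong₂ ℚ._-_ (ℚ.*-identityʳ i) (ℚ.*-identityʳ j) ⟨
    i ℚ.* 1ℚ ℚ.- j ℚ.* 1ℚ               ≡⟨ cong₂ (λ s t → i ℚ.* s ℚ.- j ℚ.* t) jb ia ⟨
    i ℚ.* (j ℚ.* b) ℚ.- j ℚ.* (i ℚ.* a) ≡⟨ diff-inv i j a b ⟩
    (i ℚ.* j) ℚ.* (b ℚ.- a)             ∎
    where open ≡-Reasoning

  recip-bound : ∀ {i j k a b d ε} → 0ℚ ℚ.≤ i → 0ℚ ℚ.≤ j → 0ℚ ℚ.≤ k →
    d ℚ.≤ a → d ℚ.≤ b → i ℚ.* a ≡ 1ℚ → j ℚ.* b ≡ 1ℚ → k ℚ.* d ≡ 1ℚ →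
    ℚ.∣ b ℚ.- a ∣ ℚ.≤ ε ℚ.* (d ℚ.* d) → ℚ.∣ i ℚ.- j ∣ ℚ.≤ ε
  recip-bound {i} {j} {k} {a} {b} {d} {ε} 0≤i 0≤j 0≤k d≤a d≤b ia jb kd h = begin
    ℚ.∣ i ℚ.- j ∣
      ≡⟨ cong ℚ.∣_∣ (recip-diff {i} {j} {a} {b} ia jb) ⟩
    ℚ.∣ (i ℚ.* j) ℚ.* (b ℚ.- a) ∣
      ≡⟨ ℚ.∣p*q∣≡∣p∣*∣q∣ (i ℚ.* j) (b ℚ.- a) ⟩
    ℚ.∣ i ℚ.* j ∣ ℚ.* ℚ.∣ b ℚ.- a ∣
      ≡⟨ cong (ℚ._* ℚ.∣ b ℚ.- a ∣) (ℚ.0≤p⇒∣p∣≡p (0≤* 0≤i 0≤j)) ⟩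
    (i ℚ.* j) ℚ.* ℚ.∣ b ℚ.- a ∣
      ≤⟨ *-mono (ℚ.0≤∣p∣ (b ℚ.- a)) (0≤* 0≤k 0≤k)
           (*-mono 0≤j 0≤k (recip-antimono 0≤i 0≤k d≤a ia kd)
             (recip-antimono 0≤j 0≤k d≤b jb kd)) h ⟩
    (k ℚ.* k) ℚ.* (ε ℚ.* (d ℚ.* d))
      ≡⟨ squares d k ε ⟩
    ε ℚ.* ((k ℚ.* d) ℚ.* (k ℚ.* d))
      ≡⟨ cong (λ t → ε ℚ.* (t ℚ.* t)) kd ⟩
    ε ℚ.* (1ℚ ℚ.* 1ℚ)
      ≡⟨ ℚ.*-identityʳ ε ⟩
    ε ∎
    where
    open ℚ.≤-Reasoning
    0≤* : ∀ {p q} → 0ℚ ℚ.≤ p → 0ℚ ℚ.≤ q → 0ℚ ℚ.≤ p ℚ.* q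
    0≤* {p} {q} 0≤p 0≤q = subst (ℚ._≤ p ℚ.* q) (ℚ.*-zeroˡ q)
      (ℚ.*-monoʳ-≤-nonNeg q {{ℚ.nonNegative 0≤q}} 0≤p)

-- The inverse of a positive real x with seq x n > δ > 0 eventually: the
-- terms are truncated below at δ, which changes only finitely many of them.
module _ (x : ℝ) (0<x : 0ℝ < x) where

  private
    δ : ℚ
    δ = proj₁ 0<x

    0<δ : 0ℚ ℚ.< δ
    0<δ = proj₁ (proj₂ 0<x)

    0<x⊔δ : ∀ n → 0ℚ ℚ.< seq x n ℚ.⊔ δ
    0<x⊔δ n = ℚ.<-≤-trans 0<δ (ℚ.p≤q⊔p (seq x n) δ)

  invSeq : ℕ → ℚ
  invSeq n = (ℚ.1/ (seq x n ℚ.⊔ δ)) {{ℚ.>-nonZero (0<x⊔δ n)}}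

  private
    inv-cauchy : IsCauchy invSeq
    inv-cauchy ε 0<ε =
      let N , h    = cauchy x (ε ℚ.* (δ ℚ.* δ)) (0<* 0<ε (0<* 0<δ 0<δ))
          N′ , h′  = proj₂ (proj₂ 0<x)
          δ<x      = λ n p → subst (ℚ._< seq x n) (ℚ.+-identityˡ δ) (h′ n p)
          x⊔δ≡x    = λ n p → ℚ.p≥q⇒p⊔q≡p (ℚ.<⇒≤ (δ<x n p))
          k , 0≤k , kδ = recip δ 0<δ
      in N ℕ.⊔ N′ , λ m n p q →
        let _ , 0≤i , ia = recip (seq x m ℚ.⊔ δ) (0<x⊔δ m)
            _ , 0≤j , jb = recip (seq x n ℚ.⊔ δ) (0<x⊔δ n)
        in recip-bound 0≤i 0≤j 0≤k
             (ℚ.p≤q⊔p (seq x m) δ) (ℚ.p≤q⊔p (seq x n) δ) ia jb kδ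
             (subst (ℚ._≤ ε ℚ.* (δ ℚ.* δ))
               (sym (cong₂ (λ s t → ℚ.∣ s ℚ.- t ∣)
                 (x⊔δ≡x n (ℕ.m⊔n≤o⇒n≤o N N′ q))
                 (x⊔δ≡x m (ℕ.m⊔n≤o⇒n≤o N N′ p))))
               (h n m (ℕ.m⊔n≤o⇒m≤o N N′ q) (ℕ.m⊔n≤o⇒m≤o N N′ p)))

  inv : ℝ
  inv = mkℝ invSeq inv-cauchy

infix 4 _⟶_

_⟶_ : (ℕ → ℝ) → ℝ → Set
a ⟶ L = ∀ ε → 0ℝ < ε → Eventually (λ n → ∣ a n - L ∣ < ε)

IsSup : (ℕ → ℝ) → ℝ → Set
IsSup a s = (∀ k → a k ≤ s) × (∀ b → (∀ k → a k ≤ b) → s ≤ b)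

-- limsup a = lim_n s n, where s n = sup_{k ≥ n} a k.
IsLimSup : (ℕ → ℝ) → ℝ → Set
IsLimSup a L =
  Σ (ℕ → ℝ) λ s → (∀ n → IsSup (λ k → a (n ℕ.+ k)) (s n)) × s ⟶ L

IsRoot : ℕ → ℝ → ℝ → Set
IsRoot n x r = 0ℝ ≤ r × r ^ n ≃ x

-- limsup θ(n)^(1/n) = L.  As θ(n)^(1/n) is undefined at n = 0, r 0 is arbitrary.
LimSupRoot : (ℕ → ℝ) → ℝ → Set
LimSupRoot θ L =
  Σ (ℕ → ℝ) λ r → (∀ n → 1 ℕ.≤ n → IsRoot n (θ n) (r n)) × IsLimSup r L

partialSum : (ℕ → ℝ) → ℕ → ℝ
partialSum a zero    = 0ℝ
partialSum a (suc N) = partialSum a N + a N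

Summable : (ℕ → ℝ) → Set
Summable a = ∃[ S ] partialSum a ⟶ S

IsRadiusOfConvergence : (ℕ → ℝ) → ℝ → Set
IsRadiusOfConvergence a ρ =
  (∀ z → ∣ z ∣ < ρ → Summable (λ n → a n * z ^ n)) ×
  (∀ z → ρ < ∣ z ∣ → ¬ Summable (λ n → a n * z ^ n))

module Submission where

-- Give an object of size n the weight q ^ n, so that the weight of a list of
-- objects is a partial sum of a generating function at q.
--
-- Upper bounds: the recursive enumerations of terms and closures turn a
-- solution x of an inequality such as q / (1 − q) + q x + q x² ≤ x into the bound
-- x on all weights.  At q = 1/7 this gives c 0 n < 7 ^ n; at q = 5/17 it gives
-- l n ≤ 6/5 (17/5) ^ n, so ∑ l n zⁿ converges at z = 2/7 and 7/25 < 2/7 ≤ ρ-L∞.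
--
-- Lower bound: at q = 5/18 there are finitely many contexts ⟨ M , □ ∷ e ⟩ of
-- total weight ≥ 1.  As filling contexts is injective, c 0 n ≥ ∑ c 0 (n − ∣ x ∣)
-- over these contexts x, so c 0 n ≥ a (18/5) ^ n with a > 0, which exceeds
-- (25/7) ^ n eventually.  Hence ρ-over = 1/7, ρ-under = 7/25 and θ = κ = 1.

import Defs
open import Defs
  using (Term; var; lam; app; ∣_∣ₜ; OpenTerm; Closure; ⟨_,_⟩; ∣_∣ᶜ; ∣_∣ᵉ;
         OpenClosure; closure; Finite; card; finiteTerms; finiteClosures;
         terms; envs; closures; l; c)
open import Algebra.Bundles using (CommutativeRing)
open import Data.Bool.Base using (T)
open import Data.Empty using (⊥-elim)
open import Data.Fin.Base using (zero; suc)
import Data.Fin.Properties as Fin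
import Data.Integer.Base as ℤ
open import Data.Integer.Solver as ℤ-Solver using ()
open import Data.List.Base
  using (List; []; _∷_; _++_; [_]; length; lookup; map; upTo; applyUpTo; filter; deduplicate;
         cartesianProductWith)
open import Data.List.Membership.Propositional using (_∈_)
open import Data.List.Membership.Propositional.Properties
  using (∈-++⁻; ∈-map⁻; ∈-lookup)
open import Data.List.Membership.Setoid.Properties using (index-injective)
open import Data.List.Properties using (map-applyUpTo; length-map; length-++)
open import Data.List.Relation.Unary.All as All using (All; []; _∷_)
import Data.List.Relation.Unary.All.Properties as All
open import Data.List.Relation.Unary.Any using (here; there; index)
open import Data.List.Relation.Unary.Unique.Propositional using (Unique; []; _∷_)
import Data.List.Relation.Unary.Unique.Propositional.Properties as Unique
open import Data.Nat.Base as ℕ using (ℕ; zero; suc; s≤s; z≤n)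
import Data.Nat.Properties as ℕ
open import Data.Nat.Induction using (<-rec)
open import Data.Product.Base using (Σ; ∃-syntax; _×_; _,_; proj₁; proj₂)
open import Data.Rational.Base as ℚ using (ℚ; 0ℚ; 1ℚ)
import Data.Rational.Properties as ℚ
open import Data.Rational.Solver using (module +-*-Solver)
import Data.Rational.Unnormalised.Base as ℚᵘ
import Data.Rational.Unnormalised.Properties as ℚᵘ
open import Data.Sum.Base using (_⊎_; inj₁; inj₂; [_,_]′)
open import Function.Base using (id; _∘_)
open import Function.Bundles using (Equivalence)
open import Relation.Binary.Definitions using (DecidableEquality)
open import Relation.Binary.PropositionalEquality as ≡
  using (_≡_; refl; sym; trans; cong; cong₂; subst; subst₂;
         module ≡-Reasoning)
open import Relation.Nullary using (¬_; yes; no; contradiction)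
open import Relation.Nullary.Decidable using (from-yes)
open import Relation.Unary using (Decidable)

open import Algebra.Properties.CommutativeSemiring.Exp
  (CommutativeRing.commutativeSemiring ℚ.+-*-commutativeRing)
  using () renaming (_^_ to infixr 9 _^ℚ_; ^-homo-* to ^ℚ-homo-*;
                     ^-distrib-* to ^ℚ-distrib-*)

-- Inequalities for rational powers, the embedding of ℕ, and geometric decay.

module Rational where

  open import Data.Rational.Base using (_+_; _*_; _≤_; _<_)
  open +-*-Solver

  0≤* : ∀ {p r} → 0ℚ ≤ p → 0ℚ ≤ r → 0ℚ ≤ p * r
  0≤* {p} {r} 0≤p 0≤r = ℚ.nonNegative⁻¹ (p * r)
    {{ℚ.nonNeg*nonNeg⇒nonNeg p {{ℚ.nonNegative 0≤p}} r {{ℚ.nonNegative 0≤r}}}}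

  0≤+ : ∀ {p r} → 0ℚ ≤ p → 0ℚ ≤ r → 0ℚ ≤ p + r
  0≤+ 0≤p 0≤r = ℚ.+-mono-≤ 0≤p 0≤r

  p≤p+r : ∀ p {r} → 0ℚ ≤ r → p ≤ p + r
  p≤p+r p {r} 0≤r = subst (_≤ p + r) (ℚ.+-identityʳ p) (ℚ.+-monoʳ-≤ p 0≤r)

  p≤r+p : ∀ p {r} → 0ℚ ≤ r → p ≤ r + p
  p≤r+p p {r} 0≤r = subst (_≤ r + p) (ℚ.+-identityˡ p) (ℚ.+-monoˡ-≤ p 0≤r)

  0<* : ∀ {p r} → 0ℚ < p → 0ℚ < r → 0ℚ < p * r
  0<* {p} {r} 0<p 0<r = ℚ.positive⁻¹ (p * r)
    {{ℚ.pos*pos⇒pos p {{ℚ.positive 0<p}} r {{ℚ.positive 0<r}}}}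

  *-monoʳ : ∀ {r p s} → 0ℚ ≤ r → p ≤ s → r * p ≤ r * s
  *-monoʳ {r} 0≤r = ℚ.*-monoˡ-≤-nonNeg r {{ℚ.nonNegative 0≤r}}

  *-mono : ∀ {p r s t} → 0ℚ ≤ p → 0ℚ ≤ r → p ≤ s → r ≤ t → p * r ≤ s * t
  *-mono {p} {r} {s} {t} 0≤p 0≤r p≤s r≤t = ℚ.≤-trans
    (*-monoʳ 0≤p r≤t)
    (ℚ.*-monoʳ-≤-nonNeg t {{ℚ.nonNegative (ℚ.≤-trans 0≤r r≤t)}} p≤s)

  0≤^ : ∀ {p} → 0ℚ ≤ p → ∀ n → 0ℚ ≤ p ^ℚ n
  0≤^ 0≤p zero    = ℚ.nonNegative⁻¹ 1ℚ
  0≤^ 0≤p (suc n) = 0≤* 0≤p (0≤^ 0≤p n)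

  0<^ : ∀ {p} → 0ℚ < p → ∀ n → 0ℚ < p ^ℚ n
  0<^ 0<p zero    = ℚ.positive⁻¹ 1ℚ
  0<^ 0<p (suc n) = 0<* 0<p (0<^ 0<p n)

  ^-≤1 : ∀ {p} → 0ℚ ≤ p → p ≤ 1ℚ → ∀ n → p ^ℚ n ≤ 1ℚ
  ^-≤1 0≤p p≤1 zero    = ℚ.≤-refl
  ^-≤1 0≤p p≤1 (suc n) = *-mono 0≤p (0≤^ 0≤p n) p≤1 (^-≤1 0≤p p≤1 n)

  1^ : ∀ n → 1ℚ ^ℚ n ≡ 1ℚ
  1^ zero    = refl
  1^ (suc n) = trans (ℚ.*-identityˡ (1ℚ ^ℚ n)) (1^ n)

  -- This is the rational inside `fromℕ n`, so that estimates on `ι` transfer to `fromℕ` by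
  -- computation.
  ι : ℕ → ℚ
  ι n = ℤ.+ n ℚ./ 1

  -- `ℤ.+ n ℚ./ 1` is normalised by a gcd and does not unfold for a variable `n`; among unnormalised
  -- fractions the claim is a ring identity in ℤ.
  ι-suc : ∀ n → ι (suc n) ≡ 1ℚ + ι n
  ι-suc n = ℚ.toℚᵘ-injective (ℚᵘ.≃-trans
    (ℚ.toℚᵘ-fromℚᵘ (ℚᵘ.mkℚᵘ (ℤ.+ suc n) 0))
    (ℚᵘ.≃-trans
      (ℚᵘ.*≡* (solve′ 1 (λ m → (con′ (ℤ.+ 1) :+′ m) :*′ con′ (ℤ.+ 1) :=′
        (con′ (ℤ.+ 1) :*′ con′ (ℤ.+ 1) :+′ m :*′ con′ (ℤ.+ 1)) :*′ con′ (ℤ.+ 1)) refl (ℤ.+ n)))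
      (ℚᵘ.≃-sym (ℚᵘ.≃-trans (ℚ.toℚᵘ-homo-+ 1ℚ (ι n))
        (ℚᵘ.+-congʳ ℚᵘ.1ℚᵘ (ℚ.toℚᵘ-fromℚᵘ (ℚᵘ.mkℚᵘ (ℤ.+ n) 0)))))))
    where
    open ℤ-Solver.+-*-Solver using ()
      renaming (solve to solve′; con to con′; _:+_ to _:+′_; _:*_ to _:*′_; _:=_ to _:=′_)

  0≤ι : ∀ n → 0ℚ ≤ ι n
  0≤ι zero    = ℚ.≤-refl
  0≤ι (suc n) = subst (0ℚ ≤_) (sym (ι-suc n)) (0≤+ (ℚ.nonNegative⁻¹ 1ℚ) (0≤ι n))

  ι-mono : ∀ {m n} → m ℕ.≤ n → ι m ≤ ι n
  ι-mono {n = n} z≤n = 0≤ι n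
  ι-mono {suc m} {suc n} (s≤s m≤n) = subst₂ _≤_ (sym (ι-suc m)) (sym (ι-suc n))
    (ℚ.+-monoʳ-≤ 1ℚ (ι-mono m≤n))

  ι-+ : ∀ m n → ι (m ℕ.+ n) ≡ ι m + ι n
  ι-+ zero    n = sym (ℚ.+-identityˡ (ι n))
  ι-+ (suc m) n = begin
    ι (suc (m ℕ.+ n))   ≡⟨ ι-suc (m ℕ.+ n) ⟩
    1ℚ + ι (m ℕ.+ n)    ≡⟨ cong (1ℚ +_) (ι-+ m n) ⟩
    1ℚ + (ι m + ι n)    ≡⟨ ℚ.+-assoc 1ℚ (ι m) (ι n) ⟨
    (1ℚ + ι m) + ι n    ≡⟨ cong (_+ ι n) (ι-suc m) ⟨
    ι (suc m) + ι n     ∎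
    where open ≡-Reasoning

  -- The denominator of `r` serves as `N`: multiplied by it, `r` becomes its positive integer
  -- numerator.
  archimedean : ∀ {r} → 0ℚ < r → ∃[ N ] 1ℚ ≤ ι N * r
  archimedean {r@(ℚ.mkℚ (ℤ.+ suc k) d-1 _)} _ = suc d-1 , ℚ.toℚᵘ-cancel-≤
    (ℚᵘ.≤-trans (ℚᵘ.*≤* bound) (ℚᵘ.≤-reflexive (ℚᵘ.≃-sym
      (ℚᵘ.≃-trans (ℚ.toℚᵘ-homo-* (ι (suc d-1)) r)
        (ℚᵘ.*-congʳ {ℚ.toℚᵘ r} (ℚ.toℚᵘ-fromℚᵘ (ℚᵘ.mkℚᵘ (ℤ.+ suc d-1) 0)))))))
    where
    bound : ℤ.+ 1 ℤ.* (ℤ.+ suc (d-1 ℕ.+ 0)) ℤ.≤ ((ℤ.+ suc d-1) ℤ.* (ℤ.+ suc k)) ℤ.* ℤ.+ 1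
    bound = ℤ.+≤+ (begin
      suc (d-1 ℕ.+ 0) ℕ.+ 0            ≡⟨ trans (ℕ.+-identityʳ _) (cong suc (ℕ.+-identityʳ d-1)) ⟩
      suc d-1                          ≤⟨ ℕ.m≤m*n (suc d-1) (suc k) ⟩
      suc d-1 ℕ.* suc k                ≡⟨ ℕ.*-identityʳ _ ⟨
      suc d-1 ℕ.* suc k ℕ.* 1          ∎)
      where open ℕ.≤-Reasoning
  archimedean {ℚ.mkℚ (ℤ.+ 0) _ _} (ℚ.*<* (ℤ.+<+ ()))
  archimedean {ℚ.mkℚ (ℤ.-[1+ _ ]) _ _} (ℚ.*<* ())

  -- Bernoulli's inequality (1 + h)ⁿ ≥ 1 + n h for θ ≤ 1 / (1 + h), kept free of division.
  bernoulli : ∀ {θ h} → 0ℚ ≤ θ → 0ℚ < h → θ * (1ℚ + h) ≤ 1ℚ →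
              ∀ n → θ ^ℚ n * (1ℚ + ι n * h) ≤ 1ℚ
  bernoulli {θ} {h} 0≤θ 0<h θ[1+h]≤1 zero = ℚ.≤-reflexive
    (solve 1 (λ h → con 1ℚ :* (con 1ℚ :+ con 0ℚ :* h) := con 1ℚ) refl h)
  bernoulli {θ} {h} 0≤θ 0<h θ[1+h]≤1 (suc n) = begin
    θ * t * (1ℚ + ι (suc n) * h)
      ≡⟨ cong (λ m → θ * t * (1ℚ + m * h)) (ι-suc n) ⟩
    θ * t * (1ℚ + (1ℚ + ι n) * h)
      -- The added n h² completes the product (1 + h) (1 + n h).
      ≤⟨ *-monoʳ (0≤* 0≤θ (0≤^ 0≤θ n)) (p≤p+r _ (0≤* (0≤ι n) (0≤* 0≤h 0≤h))) ⟩
    θ * t * (1ℚ + (1ℚ + ι n) * h + ι n * (h * h))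
      ≡⟨ solve 4 (λ θ t m h →
           θ :* t :* (con 1ℚ :+ (con 1ℚ :+ m) :* h :+ m :* (h :* h)) :=
           θ :* (con 1ℚ :+ h) :* (t :* (con 1ℚ :+ m :* h))) refl θ t (ι n) h ⟩
    θ * (1ℚ + h) * (t * (1ℚ + ι n * h))
      ≤⟨ *-mono (0≤* 0≤θ (0≤+ 0≤1 0≤h))
           (0≤* (0≤^ 0≤θ n) (0≤+ 0≤1 (0≤* (0≤ι n) 0≤h)))
           θ[1+h]≤1 (bernoulli 0≤θ 0<h θ[1+h]≤1 n) ⟩
    1ℚ ∎
    where
    open ℚ.≤-Reasoning
    t = θ ^ℚ n
    0≤h = ℚ.<⇒≤ 0<h
    0≤1 = ℚ.nonNegative⁻¹ 1ℚ

  -- Once n h ε ≥ 1, Bernoulli gives θⁿ (1 + n h) ≤ 1 < ε (1 + n h), and the positive factor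
  -- cancels.
  decay : ∀ {θ h} → 0ℚ ≤ θ → 0ℚ < h → θ * (1ℚ + h) ≤ 1ℚ →
          ∀ {ε} → 0ℚ < ε → ∃[ N ] (∀ n → N ℕ.≤ n → θ ^ℚ n < ε)
  decay {θ} {h} 0≤θ 0<h θ[1+h]≤1 {ε} 0<ε with archimedean (0<* 0<h 0<ε)
  ... | N , 1≤N[hε] = N , λ n N≤n →
    ℚ.*-cancelʳ-<-nonNeg (1ℚ + ι n * h) {{ℚ.nonNegative (0≤1+nh n)}} (begin-strict
      θ ^ℚ n * (1ℚ + ι n * h) ≤⟨ bernoulli 0≤θ 0<h θ[1+h]≤1 n ⟩
      1ℚ                      ≤⟨ 1≤N[hε] ⟩
      ι N * (h * ε)           ≤⟨ ℚ.*-monoʳ-≤-nonNeg (h * ε)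
                                   {{ℚ.nonNegative (ℚ.<⇒≤ (0<* 0<h 0<ε))}} (ι-mono N≤n) ⟩
      ι n * (h * ε)           ≡⟨ ℚ.+-identityˡ _ ⟨
      0ℚ + ι n * (h * ε)      <⟨ ℚ.+-monoˡ-< (ι n * (h * ε)) 0<ε ⟩
      ε + ι n * (h * ε)       ≡⟨ solve 3 (λ e m h →
                                   e :+ m :* (h :* e) := e :* (con 1ℚ :+ m :* h)) refl ε (ι n) h ⟩
      ε * (1ℚ + ι n * h)      ∎)
    where
    open ℚ.≤-Reasoning
    0≤1+nh : ∀ n → 0ℚ ≤ 1ℚ + ι n * h
    0≤1+nh n = 0≤+ (ℚ.nonNegative⁻¹ 1ℚ) (0≤* (0≤ι n) (ℚ.<⇒≤ 0<h))

  -- Moves a bound on a summand from the point q to q θ, where for θ < 1 it becomes a geometric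
  -- majorant.
  ≤*^⇒≤*^ : ∀ {m x q θ} → 0ℚ ≤ θ → ∀ n → m * q ^ℚ n ≤ x →
            m * (q * θ) ^ℚ n ≤ x * θ ^ℚ n
  ≤*^⇒≤*^ {m} {x} {q} {θ} 0≤θ n m≤ = begin
    m * (q * θ) ^ℚ n         ≡⟨ cong (m *_) (^ℚ-distrib-* q θ n) ⟩
    m * (q ^ℚ n * θ ^ℚ n)    ≡⟨ ℚ.*-assoc m (q ^ℚ n) (θ ^ℚ n) ⟨
    m * q ^ℚ n * θ ^ℚ n      ≤⟨ ℚ.*-monoʳ-≤-nonNeg (θ ^ℚ n) {{ℚ.nonNegative (0≤^ 0≤θ n)}} m≤ ⟩
    x * θ ^ℚ n               ∎
    where open ℚ.≤-Reasoning

  *^<⇒<^ : ∀ {m q r} → 0ℚ ≤ q → ∀ n → m * q ^ℚ n < (r * q) ^ℚ n → m < r ^ℚ n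
  *^<⇒<^ {m} {q} {r} 0≤q n h = ℚ.*-cancelʳ-<-nonNeg (q ^ℚ n) {{ℚ.nonNegative (0≤^ 0≤q n)}}
    (subst (m * q ^ℚ n <_) (^ℚ-distrib-* r q n) h)

  ^<*⇒^< : ∀ {m q r} → 0ℚ ≤ q → ∀ n → (r * q) ^ℚ n < m * q ^ℚ n → r ^ℚ n < m
  ^<*⇒^< {m} {q} {r} 0≤q n h = ℚ.*-cancelʳ-<-nonNeg (q ^ℚ n) {{ℚ.nonNegative (0≤^ 0≤q n)}}
    (subst (_< m * q ^ℚ n) (^ℚ-distrib-* r q n) h)

  -- As r q < 1, the powers (r q)ⁿ drop below `a`, hence below `m n * q ^ℚ n`; then qⁿ cancels.
  eventually-^< : ∀ {q r h a} {m : ℕ → ℚ} → 0ℚ ≤ q → 0ℚ ≤ r → 0ℚ < h →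
    r * q * (1ℚ + h) ≤ 1ℚ → ∀ M → 0ℚ < a × (∀ n → M ℕ.≤ n → a ≤ m n * q ^ℚ n) →
    ∃[ N ] (∀ n → N ℕ.≤ n → r ^ℚ n < m n)
  eventually-^< {q} {r} {m = m} 0≤q 0≤r 0<h rq≤ M (0<a , a≤) =
    let N , rq< = decay (0≤* 0≤r 0≤q) 0<h rq≤ 0<a
    in M ℕ.⊔ N , λ n p → ^<*⇒^< {m n} {q} {r} 0≤q n
      (ℚ.<-≤-trans (rq< n (ℕ.m⊔n≤o⇒n≤o M N p)) (a≤ n (ℕ.m⊔n≤o⇒m≤o M N p)))

-- Weights of lists, and how they behave under the list constructions.

module Weight (q : ℚ) (0<q : 0ℚ ℚ.< q) where

  open import Data.Rational.Base using (_+_; _*_; _≤_; _<_)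
  open +-*-Solver
  open Rational

  private
    variable
      A B C : Set

  0≤q : 0ℚ ≤ q
  0≤q = ℚ.<⇒≤ 0<q

  weight : (A → ℕ) → List A → ℚ
  weight size []       = 0ℚ
  weight size (x ∷ xs) = q ^ℚ size x + weight size xs

  module _ (size : A → ℕ) where

    0≤weight : ∀ xs → 0ℚ ≤ weight size xs
    0≤weight []       = ℚ.≤-refl
    0≤weight (x ∷ xs) = 0≤+ (0≤^ 0≤q (size x)) (0≤weight xs)

    weight-++ : ∀ xs ys → weight size (xs ++ ys) ≡ weight size xs + weight size ys
    weight-++ []       ys = sym (ℚ.+-identityˡ _)
    weight-++ (x ∷ xs) ys = trans (cong (q ^ℚ size x +_) (weight-++ xs ys))
      (sym (ℚ.+-assoc (q ^ℚ size x) (weight size xs) (weight size ys)))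

    weight-filter : {P : A → Set} (P? : Decidable P) → ∀ xs →
                    weight size (filter P? xs) ≤ weight size xs
    weight-filter P? [] = ℚ.≤-refl
    weight-filter P? (x ∷ xs) with P? x
    ... | yes _ = ℚ.+-monoʳ-≤ (q ^ℚ size x) (weight-filter P? xs)
    ... | no  _ = ℚ.≤-trans (weight-filter P? xs)
                    (p≤r+p _ (0≤^ 0≤q (size x)))

    weight-deduplicate : (_≟_ : DecidableEquality A) → ∀ xs →
                         weight size (deduplicate _≟_ xs) ≤ weight size xs
    weight-deduplicate _≟_ []       = ℚ.≤-refl
    weight-deduplicate _≟_ (x ∷ xs) = ℚ.+-monoʳ-≤ (q ^ℚ size x)
      (ℚ.≤-trans (weight-filter _ (deduplicate _≟_ xs)) (weight-deduplicate _≟_ xs))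

    weight-constant : ∀ {n xs} → All (λ x → size x ≡ n) xs →
                      weight size xs ≡ ι (length xs) * q ^ℚ n
    weight-constant {n} []                  = sym (ℚ.*-zeroˡ (q ^ℚ n))
    weight-constant {n} {x ∷ xs} (refl ∷ p) = begin
      q ^ℚ n + weight size xs             ≡⟨ cong (q ^ℚ n +_) (weight-constant p) ⟩
      q ^ℚ n + ι (length xs) * q ^ℚ n     ≡⟨ solve 2 (λ t m →
                                               t :+ m :* t := (con 1ℚ :+ m) :* t)
                                               refl (q ^ℚ n) (ι (length xs)) ⟩
      (1ℚ + ι (length xs)) * q ^ℚ n       ≡⟨ cong (_* q ^ℚ n) (ι-suc (length xs)) ⟨
      ι (suc (length xs)) * q ^ℚ n        ∎
      where open ≡-Reasoning

  weight-map : (s : A → ℕ) (t : B → ℕ) (f : A → B) (k : ℕ) →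
               (∀ x → t (f x) ≡ k ℕ.+ s x) →
               ∀ xs → weight t (map f xs) ≡ q ^ℚ k * weight s xs
  weight-map s t f k eq []       = sym (ℚ.*-zeroʳ (q ^ℚ k))
  weight-map s t f k eq (x ∷ xs) = trans
    (cong₂ _+_ (trans (cong (q ^ℚ_) (eq x)) (^ℚ-homo-* q k (s x))) (weight-map s t f k eq xs))
    (sym (ℚ.*-distribˡ-+ (q ^ℚ k) (q ^ℚ s x) (weight s xs)))

  -- The product rule for generating functions; `k` is the size of the constructor `f` itself.
  weight-product : (s : A → ℕ) (t : B → ℕ) (u : C → ℕ) (f : A → B → C) (k : ℕ) →
    (∀ x y → u (f x y) ≡ k ℕ.+ (s x ℕ.+ t y)) → ∀ xs ys →
    weight u (cartesianProductWith f xs ys) ≡ q ^ℚ k * (weight s xs * weight t ys)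
  weight-product s t u f k eq [] ys =
    solve 2 (λ a b → con 0ℚ := a :* (con 0ℚ :* b)) refl (q ^ℚ k) (weight t ys)
  weight-product s t u f k eq (x ∷ xs) ys = begin
    weight u (map (f x) ys ++ cartesianProductWith f xs ys)
      ≡⟨ weight-++ u (map (f x) ys) _ ⟩
    weight u (map (f x) ys) + weight u (cartesianProductWith f xs ys)
      ≡⟨ cong₂ _+_
           (weight-map t u (f x) (k ℕ.+ s x) (λ y → trans (eq x y) (sym (ℕ.+-assoc k (s x) (t y)))) ys)
           (weight-product s t u f k eq xs ys) ⟩
    q ^ℚ (k ℕ.+ s x) * weight t ys + q ^ℚ k * (weight s xs * weight t ys)
      ≡⟨ cong (λ e → e * weight t ys + q ^ℚ k * (weight s xs * weight t ys)) (^ℚ-homo-* q k (s x)) ⟩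
    q ^ℚ k * q ^ℚ s x * weight t ys + q ^ℚ k * (weight s xs * weight t ys)
      ≡⟨ solve 4 (λ k x a b → k :* x :* b :+ k :* (a :* b) := k :* ((x :+ a) :* b))
           refl (q ^ℚ k) (q ^ℚ s x) (weight s xs) (weight t ys) ⟩
    q ^ℚ k * ((q ^ℚ s x + weight s xs) * weight t ys) ∎
    where open ≡-Reasoning

  -- The index i has size i + 1, so these are the partial sums of q / (1 - q), here in the form of a
  -- recursion.
  weight-suc : ∀ n → weight suc (upTo (suc n)) ≡ q * (1ℚ + weight suc (upTo n))
  weight-suc n = begin
    q * 1ℚ + weight suc (applyUpTo suc n)
      ≡⟨ cong (λ xs → q * 1ℚ + weight suc xs) (map-applyUpTo id suc n) ⟨
    q * 1ℚ + weight suc (map suc (upTo n))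
      ≡⟨ cong (q * 1ℚ +_) (weight-map suc suc suc 1 (λ _ → refl) (upTo n)) ⟩
    q * 1ℚ + q * 1ℚ * weight suc (upTo n)
      ≡⟨ solve 2 (λ q w → q :* con 1ℚ :+ q :* con 1ℚ :* w := q :* (con 1ℚ :+ w))
           refl q (weight suc (upTo n)) ⟩
    q * (1ℚ + weight suc (upTo n)) ∎
    where open ≡-Reasoning

  weight-termParts : ∀ is Ms Ns →
    weight ∣_∣ₜ (map var is ++ map lam Ms ++ cartesianProductWith app Ns Ns) ≡
    weight suc is + (q * weight ∣_∣ₜ Ms + q * (weight ∣_∣ₜ Ns * weight ∣_∣ₜ Ns))
  weight-termParts is Ms Ns = begin
    weight ∣_∣ₜ (map var is ++ map lam Ms ++ cartesianProductWith app Ns Ns)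
      ≡⟨ weight-++ ∣_∣ₜ (map var is) _ ⟩
    weight ∣_∣ₜ (map var is) + weight ∣_∣ₜ (map lam Ms ++ cartesianProductWith app Ns Ns)
      ≡⟨ cong₂ _+_ (weight-map suc ∣_∣ₜ var 0 (λ n → ℕ.+-comm n 1) is) (weight-++ ∣_∣ₜ (map lam Ms) _) ⟩
    1ℚ * weight suc is + (weight ∣_∣ₜ (map lam Ms) + weight ∣_∣ₜ (cartesianProductWith app Ns Ns))
      ≡⟨ cong₂ _+_ (ℚ.*-identityˡ (weight suc is)) (cong₂ _+_
           (weight-map ∣_∣ₜ ∣_∣ₜ lam 1 (λ M → ℕ.+-comm ∣ M ∣ₜ 1) Ms)
           (weight-product ∣_∣ₜ ∣_∣ₜ ∣_∣ₜ app 1 (λ M N → ℕ.+-comm (∣ M ∣ₜ ℕ.+ ∣ N ∣ₜ) 1) Ns Ns)) ⟩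
    weight suc is + (q * 1ℚ * weight ∣_∣ₜ Ms + q * 1ℚ * (weight ∣_∣ₜ Ns * weight ∣_∣ₜ Ns))
      ≡⟨ cong (λ e → weight suc is + (e * weight ∣_∣ₜ Ms + e * (weight ∣_∣ₜ Ns * weight ∣_∣ₜ Ns)))
           (ℚ.*-identityʳ q) ⟩
    weight suc is + (q * weight ∣_∣ₜ Ms + q * (weight ∣_∣ₜ Ns * weight ∣_∣ₜ Ns)) ∎
    where open ≡-Reasoning

  weight-elements : {size : A → ℕ} {P : A → Set} (F : Finite P) → ∀ {n} →
    (∀ x → P x → size x ≡ n) → ι (card F) * q ^ℚ n ≡ weight size (Finite.elements F)
  weight-elements {size = size} F h = sym (weight-constant size
    (All.tabulate λ {x} x∈ → h x (Equivalence.to (Finite.∈-elements F x) x∈)))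

  -- Upper bounds from solutions of the recursive inequalities.

  module _ {g x : ℚ} (0≤g : 0ℚ ≤ g) (0≤x : 0ℚ ≤ x) (indices : q * (1ℚ + g) ≤ g)
           (fixpoint : g + (q * x + q * (x * x)) ≤ x) where

    weight-indices : ∀ n → weight suc (upTo n) ≤ g
    weight-indices zero    = 0≤g
    weight-indices (suc n) = begin
      weight suc (upTo (suc n))       ≡⟨ weight-suc n ⟩
      q * (1ℚ + weight suc (upTo n))  ≤⟨ *-monoʳ 0≤q (ℚ.+-monoʳ-≤ 1ℚ (weight-indices n)) ⟩
      q * (1ℚ + g)                    ≤⟨ indices ⟩
      g                               ∎
      where open ℚ.≤-Reasoning

    -- The recursion for the weights is monotone and starts at 0, so it never passes a point `x`
    -- that it maps below itself.
    weight-terms : ∀ n → weight ∣_∣ₜ (terms n) ≤ x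
    weight-terms zero    = 0≤x
    weight-terms (suc n) = begin
      weight ∣_∣ₜ (terms (suc n))
        ≡⟨ weight-termParts (upTo (suc n)) (terms n) (terms n) ⟩
      weight suc (upTo (suc n)) + (q * w + q * (w * w))
        ≤⟨ ℚ.+-mono-≤ (weight-indices (suc n)) (ℚ.+-mono-≤ (*-monoʳ 0≤q ih)
             (*-monoʳ 0≤q (*-mono (0≤weight ∣_∣ₜ (terms n)) (0≤weight ∣_∣ₜ (terms n)) ih ih))) ⟩
      g + (q * x + q * (x * x))
        ≤⟨ fixpoint ⟩
      x ∎
      where
      open ℚ.≤-Reasoning
      w = weight ∣_∣ₜ (terms n)
      ih = weight-terms n

    l-bound : ∀ n → ι (l n) * q ^ℚ n ≤ x
    l-bound n = begin
      ι (l n) * q ^ℚ n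
        ≡⟨ weight-elements (finiteTerms n) (λ _ p → p) ⟩
      weight ∣_∣ₜ (Finite.elements (finiteTerms n))
        ≤⟨ weight-deduplicate ∣_∣ₜ _ (filter _ (terms n)) ⟩
      weight ∣_∣ₜ (filter _ (terms n))
        ≤⟨ weight-filter ∣_∣ₜ _ (terms n) ⟩
      weight ∣_∣ₜ (terms n)
        ≤⟨ weight-terms n ⟩
      x ∎
      where open ℚ.≤-Reasoning

    module _ {b y : ℚ} (0≤y : 0ℚ ≤ y) (1≤b : 1ℚ ≤ b) (environments : 1ℚ + y * b ≤ b)
             (bodies : x * b ≤ y) where

      -- Lists over a weight y satisfy E = 1 + y E, and `environments` makes `b` an upper solution
      -- of this equation.
      weight-envs : ∀ {Cs} → weight ∣_∣ᶜ Cs ≤ y → ∀ n → weight ∣_∣ᵉ (envs n Cs) ≤ b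
      weight-envs h zero    = 1≤b
      weight-envs {Cs} h (suc n) = begin
        1ℚ + weight ∣_∣ᵉ (cartesianProductWith _∷_ Cs (envs n Cs))
          ≡⟨ cong (1ℚ +_) (weight-product ∣_∣ᶜ ∣_∣ᵉ ∣_∣ᵉ _∷_ 0 (λ _ _ → refl) Cs (envs n Cs)) ⟩
        1ℚ + 1ℚ * (weight ∣_∣ᶜ Cs * weight ∣_∣ᵉ (envs n Cs))
          ≡⟨ cong (1ℚ +_) (ℚ.*-identityˡ (weight ∣_∣ᶜ Cs * weight ∣_∣ᵉ (envs n Cs))) ⟩
        1ℚ + weight ∣_∣ᶜ Cs * weight ∣_∣ᵉ (envs n Cs)
          ≤⟨ ℚ.+-monoʳ-≤ 1ℚ (*-mono (0≤weight ∣_∣ᶜ Cs) (0≤weight ∣_∣ᵉ (envs n Cs)) h (weight-envs h n)) ⟩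
        1ℚ + y * b
          ≤⟨ environments ⟩
        b ∎
        where open ℚ.≤-Reasoning

      weight-closures : ∀ n → weight ∣_∣ᶜ (closures n) ≤ y
      weight-closures zero    = 0≤y
      weight-closures (suc n) = begin
        weight ∣_∣ᶜ (closures (suc n))
          ≡⟨ weight-product ∣_∣ₜ ∣_∣ᵉ ∣_∣ᶜ ⟨_,_⟩ 0 (λ _ _ → refl) (terms (suc n)) es ⟩
        1ℚ * (weight ∣_∣ₜ (terms (suc n)) * weight ∣_∣ᵉ es)
          ≡⟨ ℚ.*-identityˡ (weight ∣_∣ₜ (terms (suc n)) * weight ∣_∣ᵉ es) ⟩
        weight ∣_∣ₜ (terms (suc n)) * weight ∣_∣ᵉ es
          ≤⟨ *-mono (0≤weight ∣_∣ₜ (terms (suc n))) (0≤weight ∣_∣ᵉ es)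
               (weight-terms (suc n)) (weight-envs (weight-closures n) n) ⟩
        x * b
          ≤⟨ bodies ⟩
        y ∎
        where
        open ℚ.≤-Reasoning
        es = envs n (closures n)

      -- The openness condition is dropped together with the filter, whence one bound for all `m`.
      c-bound : ∀ m n → ι (c m n) * q ^ℚ n ≤ y
      c-bound m n = begin
        ι (c m n) * q ^ℚ n
          ≡⟨ weight-elements (finiteClosures m n) (λ _ → proj₂) ⟩
        weight ∣_∣ᶜ (Finite.elements (finiteClosures m n))
          ≤⟨ weight-deduplicate ∣_∣ᶜ _ (filter _ (closures n)) ⟩
        weight ∣_∣ᶜ (filter _ (closures n))
          ≤⟨ weight-filter ∣_∣ᶜ _ (closures n) ⟩
        weight ∣_∣ᶜ (closures n)
          ≤⟨ weight-closures n ⟩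
        y ∎
        where open ℚ.≤-Reasoning

  -- Duplicate-free families with a guaranteed weight, for lower bounds.

  record Family (size : A → ℕ) (P : A → Set) (w : ℚ) : Set where
    constructor family
    field
      0≤w     : 0ℚ ≤ w
      members : List A
      unique  : Unique members
      all     : All P members
      w≤      : w ≤ weight size members

  open Family

  empty : {size : A → ℕ} {P : A → Set} → Family size P 0ℚ
  empty = family ℚ.≤-refl [] [] [] ℚ.≤-refl

  -- Allows weights to be rounded down between steps; for this a `Family` carries a lower bound and
  -- not its exact weight.
  weaken : ∀ {size : A → ℕ} {P Q : A → Set} {v w} → (∀ {x} → P x → Q x) →
           0ℚ ≤ v → v ≤ w → Family size P w → Family size Q v
  weaken P⊆Q 0≤v v≤w (family _ xs u a h) =
    family 0≤v xs u (All.map P⊆Q a) (ℚ.≤-trans v≤w h)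

  union : ∀ {size : A → ℕ} {P Q R : A → Set} {v w} →
          (∀ {x} → P x → ¬ Q x) → (∀ {x} → P x → R x) → (∀ {x} → Q x → R x) →
          Family size P v → Family size Q w → Family size R (v + w)
  union {size = size} P#Q P⊆R Q⊆R (family 0≤v xs u a h) (family 0≤w ys u′ a′ h′) = family
    (0≤+ 0≤v 0≤w) (xs ++ ys)
    (Unique.++⁺ u u′ λ (x∈xs , x∈ys) → P#Q (All.lookup a x∈xs) (All.lookup a′ x∈ys))
    (All.++⁺ (All.map P⊆R a) (All.map Q⊆R a′))
    (subst (_ ≤_) (sym (weight-++ size xs ys)) (ℚ.+-mono-≤ h h′))

  image : ∀ (s : A → ℕ) (t : B → ℕ) {P Q w} (f : A → B) (k : ℕ) →
          (∀ {x y} → f x ≡ f y → x ≡ y) → (∀ x → t (f x) ≡ k ℕ.+ s x) →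
          (∀ {x} → P x → Q (f x)) → Family s P w → Family t Q (q ^ℚ k * w)
  image s t f k inj eq P⇒Q (family 0≤w xs u a h) = family
    (0≤* (0≤^ 0≤q k) 0≤w) (map f xs) (Unique.map⁺ inj u) (All.map⁺ (All.map P⇒Q a))
    (subst (_ ≤_) (sym (weight-map s t f k eq xs)) (*-monoʳ (0≤^ 0≤q k) h))

  product : ∀ (s : A → ℕ) (t : B → ℕ) (u : C → ℕ) {P Q R v w} (f : A → B → C) (k : ℕ) →
            (∀ {a a′ b b′} → f a b ≡ f a′ b′ → a ≡ a′ × b ≡ b′) →
            (∀ x y → u (f x y) ≡ k ℕ.+ (s x ℕ.+ t y)) →
            (∀ {x y} → P x → Q y → R (f x y)) →
            Family s P v → Family t Q w → Family u R (q ^ℚ k * (v * w))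
  product s t u f k inj eq PQ⇒R (family 0≤v xs un a h) (family 0≤w ys un′ a′ h′) = family
    (0≤* (0≤^ 0≤q k) (0≤* 0≤v 0≤w)) (cartesianProductWith f xs ys)
    (Unique.cartesianProductWith⁺ f inj un un′)
    (All.cartesianProductWith⁺ (≡.setoid _) (≡.setoid _) f xs ys
      (λ x∈ y∈ → PQ⇒R (All.lookup a x∈) (All.lookup a′ y∈)))
    (subst (_ ≤_) (sym (weight-product s t u f k eq xs ys))
      (*-monoʳ (0≤^ 0≤q k) (*-mono 0≤v 0≤w h h′)))

  IsVar : Term → Set
  IsVar M = ∃[ n ] M ≡ var n

  IsLam : Term → Set
  IsLam M = ∃[ N ] M ≡ lam N

  indices : ∀ m → Family ∣_∣ₜ (λ M → OpenTerm m M × IsVar M) (weight suc (upTo m))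
  indices m = weaken id (0≤weight suc (upTo m)) (ℚ.≤-reflexive (sym (ℚ.*-identityˡ _)))
    (image suc ∣_∣ₜ var 0 (λ { refl → refl }) (λ n → ℕ.+-comm n 1) (λ n<m → var n<m , _ , refl)
      (family (0≤weight suc (upTo m)) (upTo m) (Unique.upTo⁺ m) (All.all-upTo m) ℚ.≤-refl))

  -- The counterpart of `weight-termParts` that keeps track of openness. The head constructors,
  -- recorded by `IsVar` and `IsLam`, make the three parts disjoint.
  termFamily : ∀ {m v w} → Family ∣_∣ₜ (OpenTerm (suc m)) v → Family ∣_∣ₜ (OpenTerm m) w →
               Family ∣_∣ₜ (OpenTerm m)
                 (weight suc (upTo m) + (q ^ℚ 1 * v + q ^ℚ 1 * (w * w)))
  termFamily {m} F G =
    union (λ { (_ , _ , refl) (_ , ¬var) → ¬var (_ , refl) }) proj₁ proj₁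
      (indices m)
      (union {P = λ M → OpenTerm m M × IsLam M} {Q = λ M → OpenTerm m M × ¬ IsVar M × ¬ IsLam M}
        {R = λ M → OpenTerm m M × ¬ IsVar M}
        (λ (_ , isLam) (_ , _ , ¬lam) → ¬lam isLam)
        (λ { (o , _ , refl) → o , λ () }) (λ (o , ¬var , _) → o , ¬var)
        (image ∣_∣ₜ ∣_∣ₜ lam 1 (λ { refl → refl }) (λ M → ℕ.+-comm ∣ M ∣ₜ 1)
          (λ o → lam o , _ , refl) F)
        (product ∣_∣ₜ ∣_∣ₜ ∣_∣ₜ app 1 (λ { refl → refl , refl })
          (λ M N → ℕ.+-comm (∣ M ∣ₜ ℕ.+ ∣ N ∣ₜ) 1)
          (λ o o′ → app o o′ , (λ ()) , (λ ())) G G))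

  envFamily : ∀ {P w} → Family ∣_∣ᶜ P w → ∀ k →
              Family ∣_∣ᵉ (λ e → length e ≡ k × All P e) (w ^ℚ k)
  envFamily F zero = family (0≤^ (0≤w F) 0) [ [] ] ([] ∷ []) ((refl , []) ∷ [])
    (ℚ.≤-reflexive (sym (ℚ.+-identityʳ 1ℚ)))
  envFamily F (suc k) = weaken id (0≤^ (0≤w F) (suc k)) (ℚ.≤-reflexive (sym (ℚ.*-identityˡ _)))
    (product ∣_∣ᶜ ∣_∣ᵉ ∣_∣ᵉ _∷_ 0 (λ { refl → refl , refl }) (λ _ _ → refl)
      (λ { p (refl , ps) → refl , p ∷ ps }) F (envFamily F k))

  -- The pairs ⟨ M , e ⟩ that become a closed closure once h closed closures
  -- are put in front of e: closed closures for h ≡ 0, contexts with a hole for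
  -- a single closure for h ≡ 1.
  Holes : ℕ → Closure → Set
  Holes h ⟨ M , e ⟩ = OpenTerm (h ℕ.+ length e) M × All (OpenClosure 0) e

  arity : Closure → ℕ
  arity ⟨ M , e ⟩ = length e

  HolesBelow : ℕ → ℕ → Closure → Set
  HolesBelow h k C = Holes h C × arity C ℕ.< k

  -- The generating function of `Holes h` is the sum over k of that of (h + k)-open terms times the
  -- k-th power of that of closed closures. Each use adds one summand; the arity separates it from
  -- the earlier ones.
  addArity : ∀ {h k t s w} → Family ∣_∣ᶜ (HolesBelow h k) w →
             Family ∣_∣ₜ (OpenTerm (h ℕ.+ k)) t → Family ∣_∣ᶜ (OpenClosure 0) s →
             Family ∣_∣ᶜ (HolesBelow h (suc k)) (w + t * s ^ℚ k)
  addArity {h} {k} {t} {s} F T S =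
    union {Q = λ C → Holes h C × arity C ≡ k}
      (λ { (_ , <k) (_ , refl) → ℕ.<-irrefl refl <k })
      (λ (o , <k) → o , ℕ.m<n⇒m<1+n <k) (λ { (o , refl) → o , ℕ.≤-refl })
      F
      (weaken id (0≤* (0≤w T) (0≤^ (0≤w S) k)) (ℚ.≤-reflexive (sym (ℚ.*-identityˡ _)))
        (product ∣_∣ₜ ∣_∣ᵉ ∣_∣ᶜ ⟨_,_⟩ 0 (λ { refl → refl , refl }) (λ _ _ → refl)
          (λ { o (refl , os) → (o , os) , refl }) T (envFamily S k)))

  closedClosure : ∀ {C} → Holes 0 C → OpenClosure 0 C
  closedClosure {⟨ M , e ⟩} (o , os) = closure (length e) o refl os

  -- Counting closed closures by filling contexts.

  lookup-injective : ∀ {xs : List A} → Unique xs → ∀ i j →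
                     lookup xs i ≡ lookup xs j → i ≡ j
  lookup-injective (x∉ ∷ u) zero    zero    eq = refl
  lookup-injective (x∉ ∷ u) zero    (suc j) eq = contradiction eq (All.lookup x∉ (∈-lookup j))
  lookup-injective (x∉ ∷ u) (suc i) zero    eq = contradiction (sym eq) (All.lookup x∉ (∈-lookup i))
  lookup-injective (x∉ ∷ u) (suc i) (suc j) eq = cong suc (lookup-injective u i j eq)

  -- Sending a position in `xs` to the position in `ys` of the same element is injective, so the
  -- pigeonhole principle on `Fin` applies.
  unique-⊆⇒length≤ : ∀ {xs ys : List A} → Unique xs → (∀ {x} → x ∈ xs → x ∈ ys) →
                     length xs ℕ.≤ length ys
  unique-⊆⇒length≤ {xs = xs} u xs⊆ys = Fin.injective⇒≤
    {f = λ i → index (xs⊆ys (∈-lookup i))}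
    λ {i} {j} eq → lookup-injective u i j
      (index-injective (≡.setoid _) (xs⊆ys (∈-lookup i)) (xs⊆ys (∈-lookup j)) eq)

  length≤card : {P : A → Set} (F : Finite P) → ∀ {xs} → Unique xs → All P xs →
                length xs ℕ.≤ card F
  length≤card F u a = unique-⊆⇒length≤ u
    (λ x∈ → Equivalence.from (Finite.∈-elements F _) (All.lookup a x∈))

  fill : Closure → Closure → Closure
  fill ⟨ M , e ⟩ C = ⟨ M , C ∷ e ⟩

  fill-injective : ∀ {x y C D} → fill x C ≡ fill y D → x ≡ y × C ≡ D
  fill-injective {⟨ _ , _ ⟩} {⟨ _ , _ ⟩} refl = refl , refl

  fill-closed : ∀ {x C} → Holes 1 x → OpenClosure 0 C → OpenClosure 0 (fill x C)
  fill-closed {⟨ M , e ⟩} (o , os) oC = closure (suc (length e)) o refl (oC ∷ os)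

  ∣fill∣ : ∀ x C → ∣ fill x C ∣ᶜ ≡ ∣ x ∣ᶜ ℕ.+ ∣ C ∣ᶜ
  ∣fill∣ ⟨ M , e ⟩ C = trans (cong (∣ M ∣ₜ ℕ.+_) (ℕ.+-comm ∣ C ∣ᶜ ∣ e ∣ᵉ))
    (sym (ℕ.+-assoc ∣ M ∣ₜ ∣ e ∣ᵉ ∣ C ∣ᶜ))

  0<∣_∣ : ∀ C → 0 ℕ.< ∣ C ∣ᶜ
  0<∣ ⟨ M , e ⟩ ∣ = ℕ.≤-trans (0<∣M∣ M) (ℕ.m≤m+n ∣ M ∣ₜ ∣ e ∣ᵉ)
    where
    0<∣M∣ : ∀ M → 0 ℕ.< ∣ M ∣ₜ
    0<∣M∣ (var n)   = ℕ.m≤n+m 1 n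
    0<∣M∣ (lam M)   = ℕ.m≤n+m 1 ∣ M ∣ₜ
    0<∣M∣ (app M N) = ℕ.m≤n+m 1 (∣ M ∣ₜ ℕ.+ ∣ N ∣ₜ)

  ClosedOfSize : ℕ → Closure → Set
  ClosedOfSize n C = OpenClosure 0 C × ∣ C ∣ᶜ ≡ n

  -- The filler takes up the size that the context leaves. The truncation in `∸` is harmless, as
  -- `fillings-closed` and `fillings-count` assume contexts of size ≤ n.
  fillings : ℕ → List Closure → List Closure
  fillings n []       = []
  fillings n (x ∷ xs) =
    map (fill x) (Finite.elements (finiteClosures 0 (n ℕ.∸ ∣ x ∣ᶜ))) ++ fillings n xs

  ∈-fillings : ∀ {n C} xs → C ∈ fillings n xs → ∃[ x ] ∃[ D ] x ∈ xs × C ≡ fill x D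
  ∈-fillings {n} (x ∷ xs) C∈ with ∈-++⁻ (map (fill x) _) C∈
  ... | inj₁ C∈map with ∈-map⁻ (fill x) C∈map
  ...   | D , _ , eq = x , D , here refl , eq
  ∈-fillings {n} (x ∷ xs) C∈ | inj₂ C∈rest with ∈-fillings xs C∈rest
  ...   | y , D , y∈ , eq = y , D , there y∈ , eq

  -- A filled context determines its filler, which excludes repetitions for one context, and the
  -- context, which excludes them across contexts.
  fillings-unique : ∀ {n xs} → Unique xs → Unique (fillings n xs)
  fillings-unique [] = []
  fillings-unique {n} {x ∷ xs} (x∉ ∷ u) = Unique.++⁺
    (Unique.map⁺ (proj₂ ∘ fill-injective {x} {x}) (Finite.unique (finiteClosures 0 (n ℕ.∸ ∣ x ∣ᶜ))))
    (fillings-unique u)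
    disjoint
    where
    es = Finite.elements (finiteClosures 0 (n ℕ.∸ ∣ x ∣ᶜ))
    disjoint : ∀ {C} → ¬ (C ∈ map (fill x) es × C ∈ fillings n xs)
    disjoint (C∈ , C∈′) with ∈-map⁻ (fill x) C∈ | ∈-fillings xs C∈′
    ... | D , _ , refl | y , E , y∈ , eq =
      All.lookup x∉ y∈ (proj₁ (fill-injective {x} {y} eq))

  fillings-closed : ∀ {n xs} → All (Holes 1) xs → All (λ x → ∣ x ∣ᶜ ℕ.≤ n) xs →
                    All (ClosedOfSize n) (fillings n xs)
  fillings-closed [] [] = []
  fillings-closed {n} {x ∷ xs} (h ∷ hs) (≤n ∷ ≤ns) = All.++⁺
    (All.map⁺ (All.tabulate λ {C} C∈ →
      let o , eq = Equivalence.to (Finite.∈-elements (finiteClosures 0 (n ℕ.∸ ∣ x ∣ᶜ)) C) C∈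
      in fill-closed h o ,
         trans (∣fill∣ x C) (trans (cong (∣ x ∣ᶜ ℕ.+_) eq) (ℕ.m+[n∸m]≡n ≤n))))
    (fillings-closed hs ≤ns)

  -- With k = ∣ x ∣ᶜ, the fillings of x contribute c 0 (n - k) qⁿ = (c 0 (n - k) qⁿ⁻ᵏ) qᵏ ≥ A qᵏ.
  fillings-count : ∀ {A n} xs → All (λ x → ∣ x ∣ᶜ ℕ.≤ n) xs →
    (∀ {x} → x ∈ xs → A ≤ ι (c 0 (n ℕ.∸ ∣ x ∣ᶜ)) * q ^ℚ (n ℕ.∸ ∣ x ∣ᶜ)) →
    A * weight ∣_∣ᶜ xs ≤ ι (length (fillings n xs)) * q ^ℚ n
  fillings-count {A} {n} [] [] h = ℚ.≤-reflexive
    (solve 2 (λ a t → a :* con 0ℚ := con 0ℚ :* t) refl A (q ^ℚ n))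
  fillings-count {A} {n} (x ∷ xs) (≤n ∷ ≤ns) h = begin
    A * (q ^ℚ k + weight ∣_∣ᶜ xs)
      ≡⟨ ℚ.*-distribˡ-+ A (q ^ℚ k) (weight ∣_∣ᶜ xs) ⟩
    A * q ^ℚ k + A * weight ∣_∣ᶜ xs
      ≤⟨ ℚ.+-mono-≤
           (ℚ.*-monoʳ-≤-nonNeg (q ^ℚ k) {{ℚ.nonNegative (0≤^ 0≤q k)}} (h (here refl)))
           (fillings-count xs ≤ns (h ∘ there)) ⟩
    ι (c 0 (n ℕ.∸ k)) * q ^ℚ (n ℕ.∸ k) * q ^ℚ k + ι (length (fillings n xs)) * q ^ℚ n
      ≡⟨ cong (_+ ι (length (fillings n xs)) * q ^ℚ n)
           (trans (ℚ.*-assoc (ι (c 0 (n ℕ.∸ k))) (q ^ℚ (n ℕ.∸ k)) (q ^ℚ k))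
             (cong (ι (c 0 (n ℕ.∸ k)) *_) (trans (sym (^ℚ-homo-* q (n ℕ.∸ k) k))
               (cong (q ^ℚ_) (ℕ.m∸n+n≡m ≤n))))) ⟩
    ι (c 0 (n ℕ.∸ k)) * q ^ℚ n + ι (length (fillings n xs)) * q ^ℚ n
      ≡⟨ ℚ.*-distribʳ-+ (q ^ℚ n) (ι (c 0 (n ℕ.∸ k))) (ι (length (fillings n xs))) ⟨
    (ι (c 0 (n ℕ.∸ k)) + ι (length (fillings n xs))) * q ^ℚ n
      ≡⟨ cong (_* q ^ℚ n) (trans (sym (ι-+ (c 0 (n ℕ.∸ k)) (length (fillings n xs))))
           (cong ι (sym (trans (length-++ (map (fill x) es))
             (cong (ℕ._+ length (fillings n xs)) (length-map (fill x) es)))))) ⟩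
    ι (length (map (fill x) es ++ fillings n xs)) * q ^ℚ n ∎
    where
    open ℚ.≤-Reasoning
    k = ∣ x ∣ᶜ
    es = Finite.elements (finiteClosures 0 (n ℕ.∸ k))

  lams : ℕ → Term
  lams zero    = var 0
  lams (suc k) = lam (lams k)

  ∣lams∣ : ∀ k → ∣ lams k ∣ₜ ≡ suc k
  ∣lams∣ zero    = refl
  ∣lams∣ (suc k) = trans (ℕ.+-comm ∣ lams k ∣ₜ 1) (cong suc (∣lams∣ k))

  lams-open : ∀ k m → OpenTerm (suc m) (lams k)
  lams-open zero    m = var (s≤s z≤n)
  lams-open (suc k) m = lam (lams-open k (suc m))

  -- Witnessed by n - 1 abstractions over the index 0, in the empty environment. For n = 1 only a
  -- bare index is left, which is not closed.
  0<c : ∀ {n} → 2 ℕ.≤ n → 1 ℕ.≤ c 0 n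
  0<c {suc (suc k)} _ = length≤card (finiteClosures 0 (suc (suc k)))
    {xs = [ ⟨ lams (suc k) , [] ⟩ ]} ([] ∷ [])
    ((closure 0 (lam (lams-open k 0)) refl [] ,
      trans (ℕ.+-identityʳ _) (∣lams∣ (suc k))) ∷ [])
  0<c {suc zero} (s≤s ())

  bounded : ∀ (size : A → ℕ) xs → ∃[ K ] All (λ x → size x ℕ.≤ K) xs
  bounded size []       = 0 , []
  bounded size (x ∷ xs) with bounded size xs
  ... | K , h = size x ℕ.+ K , ℕ.m≤m+n _ K ∷ All.map (λ p → ℕ.≤-trans p (ℕ.m≤n+m K (size x))) h

  Bound : ℚ → ℕ → Set
  Bound a n = a ≤ ι (c 0 n) * q ^ℚ n

  -- Already one closed closure suffices: qᵏ ≤ qⁿ ≤ c 0 n qⁿ.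
  c-lower-base : ∀ {n k} → q ≤ 1ℚ → 2 ℕ.≤ n → n ℕ.≤ k → Bound (q ^ℚ k) n
  c-lower-base {n} {k} q≤1 2≤n n≤k = begin
    q ^ℚ k                      ≡⟨ cong (q ^ℚ_) (ℕ.m∸n+n≡m n≤k) ⟨
    q ^ℚ (k ℕ.∸ n ℕ.+ n)        ≡⟨ ^ℚ-homo-* q (k ℕ.∸ n) n ⟩
    q ^ℚ (k ℕ.∸ n) * q ^ℚ n     ≤⟨ ℚ.*-monoʳ-≤-nonNeg (q ^ℚ n) {{ℚ.nonNegative (0≤^ 0≤q n)}}
                                     (ℚ.≤-trans (^-≤1 0≤q q≤1 (k ℕ.∸ n)) (ι-mono (0<c 2≤n))) ⟩
    ι (c 0 n) * q ^ℚ n          ∎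
    where open ℚ.≤-Reasoning

  -- Unfolding a closed closure at its first hole gives c 0 n ≥ ∑ c 0 (n − ∣ x ∣)
  -- over any set of contexts x; if their total weight is ≥ 1, then a lower bound
  -- for q ^ m * c 0 m propagates from m < n to n.
  c-lower-step : ∀ {xs a K n} → Unique xs → All (Holes 1) xs →
    All (λ x → ∣ x ∣ᶜ ℕ.≤ K) xs → 1ℚ ≤ weight ∣_∣ᶜ xs → 0ℚ ≤ a → K ℕ.+ 1 ℕ.< n →
    (∀ {m} → m ℕ.< n → 2 ℕ.≤ m → Bound a m) → Bound a n
  c-lower-step {xs} {a} {K} {n} u hs ≤K 1≤xs 0≤a K+1<n rec = begin
    a                                     ≡⟨ ℚ.*-identityʳ a ⟨
    a * 1ℚ                                ≤⟨ *-monoʳ 0≤a 1≤xs ⟩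
    a * weight ∣_∣ᶜ xs                    ≤⟨ fillings-count xs ≤n smaller ⟩
    ι (length (fillings n xs)) * q ^ℚ n   ≤⟨ ℚ.*-monoʳ-≤-nonNeg (q ^ℚ n)
                                               {{ℚ.nonNegative (0≤^ 0≤q n)}}
                                               (ι-mono (length≤card (finiteClosures 0 n)
                                                 (fillings-unique u) (fillings-closed hs ≤n))) ⟩
    ι (c 0 n) * q ^ℚ n                    ∎
    where
    open ℚ.≤-Reasoning
    2+K≤n : 2 ℕ.+ K ℕ.≤ n
    2+K≤n = subst (ℕ._< n) (ℕ.+-comm K 1) K+1<n
    ≤n : All (λ x → ∣ x ∣ᶜ ℕ.≤ n) xs
    ≤n = All.map (λ p → ℕ.≤-trans p (ℕ.m+n≤o⇒n≤o 2 2+K≤n)) ≤K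
    smaller : ∀ {x} → x ∈ xs → Bound a (n ℕ.∸ ∣ x ∣ᶜ)
    smaller {x} x∈ = rec
      (ℕ.∸-monoʳ-< 0<∣ x ∣ (All.lookup ≤n x∈))
      (ℕ.m+n≤o⇒m≤o∸n 2 (ℕ.≤-trans (ℕ.+-monoʳ-≤ 2 (All.lookup ≤K x∈)) 2+K≤n))

  c-lower : ∀ {w} → q ≤ 1ℚ → 1ℚ ≤ w → Family ∣_∣ᶜ (Holes 1) w →
            ∃[ a ] (0ℚ < a × (∀ n → 2 ℕ.≤ n → Bound a n))
  c-lower q≤1 1≤w (family _ xs u hs w≤) =
    let K , ≤K = bounded ∣_∣ᶜ xs
    -- Contexts have size at most K, so from n = K + 2 on every remainder n - ∣ x ∣ is at least 2,
    -- where the induction hypothesis applies; smaller n fall under the base case.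
    in q ^ℚ (K ℕ.+ 1) , 0<^ 0<q (K ℕ.+ 1) , <-rec _ λ n rec 2≤n →
      [ c-lower-base q≤1 2≤n
      , (λ K+1<n → c-lower-step u hs ≤K (ℚ.≤-trans 1≤w w≤) (0≤^ 0≤q (K ℕ.+ 1)) K+1<n rec)
      ]′ (ℕ.≤-<-connex n (K ℕ.+ 1))

-- Numerical construction of contexts of total weight at least 1.

module Contexts where

  open import Data.Rational.Base using (_+_; _*_; _≤_; _<_; _≤ᵇ_)
  open Rational

  -- Slightly below 7/25, so that (18/5)ⁿ outgrows (25/7)ⁿ.
  q : ℚ
  q = ℤ.+ 5 ℚ./ 18

  0<q : 0ℚ < q
  0<q = from-yes (0ℚ ℚ.<? q)

  open Weight q 0<q

  infix 8 _%

  _% : ℕ → ℚ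
  n % = ℤ.+ n ℚ./ 100

  0≤% : ∀ n → 0ℚ ≤ n %
  0≤% n = ℚ.nonNegative⁻¹ (n %) {{ℚ.normalize-nonNeg n 100}}

  record Terms (a b c : ℕ) : Set where
    constructor mkTerms
    field
      terms₀ : Family ∣_∣ₜ (OpenTerm 0) (a %)
      terms₁ : Family ∣_∣ₜ (OpenTerm 1) (b %)
      terms₂ : Family ∣_∣ₜ (OpenTerm 2) (c %)

  open-suc : ∀ {m M} → OpenTerm m M → OpenTerm (suc m) M
  open-suc (var n<m)  = var (ℕ.m<n⇒m<1+n n<m)
  open-suc (lam o)    = lam (open-suc o)
  open-suc (app o o′) = app (open-suc o) (open-suc o′)

  termWeight : ℕ → ℕ → ℕ → ℚ
  termWeight m v w = weight suc (upTo m) + (q ^ℚ 1 * v % + q ^ℚ 1 * (w % * w %))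

  growTerm : ∀ m v w w′ → T (w′ % ≤ᵇ termWeight m v w) →
             Family ∣_∣ₜ (OpenTerm (suc m)) (v %) → Family ∣_∣ₜ (OpenTerm m) (w %) →
             Family ∣_∣ₜ (OpenTerm m) (w′ %)
  growTerm m v w w′ ≤ F G = weaken id (0≤% w′) (ℚ.≤ᵇ⇒≤ ≤) (termFamily F G)

  grow : ∀ {a b c} a′ b′ c′ {_ : T (a′ % ≤ᵇ termWeight 0 b a)}
         {_ : T (b′ % ≤ᵇ termWeight 1 c b)} {_ : T (c′ % ≤ᵇ termWeight 2 c c)} →
         Terms a b c → Terms a′ b′ c′
  grow {a} {b} {c} a′ b′ c′ {≤a} {≤b} {≤c} (mkTerms F₀ F₁ F₂) = mkTerms
    (growTerm 0 b a a′ ≤a F₁ F₀) (growTerm 1 c b b′ ≤b F₂ F₁)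
    -- The hierarchy of openness is cut off at 2: here 2-open terms stand in for the 3-open bodies
    -- of abstractions.
    (growTerm 2 c c c′ ≤c (weaken open-suc (0≤% c) ℚ.≤-refl F₂) F₂)

  -- The numerals are hundredths: each step bounds the weights by the recursion of
  -- termFamily, rounded down; likewise for closures below.
  terms₀₋₂ : Terms 14 51 62
  terms₀₋₂ = grow 14 51 62 (grow 13 50 61 (grow 12 48 59 (grow 10 45 55
    (grow 7 39 48 (grow {0} {0} {0} 0 27 35 (mkTerms empty empty empty))))))

  open Terms terms₀₋₂

  record Closed (s : ℕ) : Set where
    constructor closed
    field
      closedClosures : Family ∣_∣ᶜ (OpenClosure 0) (s %)

  open Closed

  -- Only environments of length 0, 1 and 2 are counted. The bracketing and the initial `0ℚ` are
  -- those produced by the nested `addArity`.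
  closureWeight : ℕ → ℚ
  closureWeight s = ((0ℚ + 14 % * (s %) ^ℚ 0) + 51 % * (s %) ^ℚ 1) + 62 % * (s %) ^ℚ 2

  growClosed : ∀ {s} s′ {_ : T (s′ % ≤ᵇ closureWeight s)} → Closed s → Closed s′
  growClosed s′ {≤} (closed S) = closed
    (weaken (closedClosure ∘ proj₁) (0≤% s′) (ℚ.≤ᵇ⇒≤ ≤)
      (addArity (addArity (addArity empty terms₀ S) terms₁ S) terms₂ S))

  -- The map s ↦ 0.14 + 0.51 s + 0.62 s² exceeds s by more than 0.04 everywhere, so the rounds keep
  -- climbing in spite of the rounding. They stop once 0.51 + 0.62 s, the weight of the contexts, is
  -- at least 1.
  closed-82 : Closed 82
  closed-82 = growClosed 82 (growClosed 72 (growClosed 64 (growClosed 58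
    (growClosed 53 (growClosed 49 (growClosed 45 (growClosed 41 (growClosed 37
    (growClosed 33 (growClosed 28 (growClosed 22 (growClosed {0} 14
    (closed empty)))))))))))))

  contextWeight : ℚ
  contextWeight = (0ℚ + 51 % * (82 %) ^ℚ 0) + 62 % * (82 %) ^ℚ 1

  contexts : Family ∣_∣ᶜ (Holes 1) contextWeight
  contexts = weaken proj₁ (ℚ.≤ᵇ⇒≤ _) ℚ.≤-refl
    (addArity (addArity empty terms₁ (closedClosures closed-82)) terms₂ (closedClosures closed-82))

  c-exponential : ∃[ a ] (0ℚ < a × (∀ n → 2 ℕ.≤ n → a ≤ ι (c 0 n) * q ^ℚ n))
  c-exponential = c-lower (ℚ.≤ᵇ⇒≤ _) (ℚ.≤ᵇ⇒≤ _) contexts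

-- The exponential bounds on `c 0 n` and `l n`.

module Bounds where

  open import Data.Rational.Base using (_+_; _*_; _≤_; _<_; _/_)
  open Rational

  module W₁ = Weight (ℤ.+ 1 / 7) (from-yes (0ℚ ℚ.<? ℤ.+ 1 / 7))
  module W₂ = Weight (ℤ.+ 5 / 17) (from-yes (0ℚ ℚ.<? ℤ.+ 5 / 17))

  c[1/7]^n≤ : ∀ n → ι (c 0 n) * (ℤ.+ 1 / 7) ^ℚ n ≤ ℤ.+ 1 / 2
  -- At q = 1/7, q / (1 - q) is 1/6 and 1/4 bounds the terms. With y = 1/2 and b = 2 the conditions
  -- 1 + y b ≤ b and b / 4 ≤ y are equalities.
  c[1/7]^n≤ = W₁.c-bound {ℤ.+ 1 / 6} {ℤ.+ 1 / 4} (ℚ.≤ᵇ⇒≤ _) (ℚ.≤ᵇ⇒≤ _) (ℚ.≤ᵇ⇒≤ _) (ℚ.≤ᵇ⇒≤ _)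
    {ℤ.+ 2 / 1} {ℤ.+ 1 / 2} (ℚ.≤ᵇ⇒≤ _) (ℚ.≤ᵇ⇒≤ _) (ℚ.≤ᵇ⇒≤ _) (ℚ.≤ᵇ⇒≤ _) 0

  c<7^n : ∀ n → ι (c 0 n) < (ℤ.+ 7 / 1) ^ℚ n
  c<7^n n = *^<⇒<^ {ι (c 0 n)} {ℤ.+ 1 / 7} {ℤ.+ 7 / 1} (ℚ.≤ᵇ⇒≤ _) n
    (ℚ.≤-<-trans (c[1/7]^n≤ n)
      (subst (ℤ.+ 1 / 2 <_) (sym (1^ n)) (from-yes (ℤ.+ 1 / 2 ℚ.<? 1ℚ))))

  [25/7]^n<c : ∃[ N ] (∀ n → N ℕ.≤ n → (ℤ.+ 25 / 7) ^ℚ n < ι (c 0 n))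
  -- 25/7 · 5/18 = 125/126 = 1 / (1 + 1/125).
  [25/7]^n<c = eventually-^< {Contexts.q} {ℤ.+ 25 / 7} {ℤ.+ 1 / 125} {m = λ n → ι (c 0 n)}
    (ℚ.<⇒≤ Contexts.0<q) (ℚ.≤ᵇ⇒≤ _) (from-yes (0ℚ ℚ.<? ℤ.+ 1 / 125)) (ℚ.≤ᵇ⇒≤ _)
    2 (proj₂ Contexts.c-exponential)

  l[5/17]^n≤ : ∀ n → ι (l n) * (ℤ.+ 5 / 17) ^ℚ n ≤ ℤ.+ 6 / 5
  -- 5/12 is q / (1 - q) at q = 5/17 ≈ 0.2941, and 5/12 + q (6/5 + 36/25) ≈ 1.193 ≤ 6/5.
  l[5/17]^n≤ = W₂.l-bound {ℤ.+ 5 / 12} {ℤ.+ 6 / 5} (ℚ.≤ᵇ⇒≤ _) (ℚ.≤ᵇ⇒≤ _) (ℚ.≤ᵇ⇒≤ _) (ℚ.≤ᵇ⇒≤ _)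

  l[2/7]^n≤ : ∀ n → ι (l n) * (ℤ.+ 2 / 7) ^ℚ n ≤ ℤ.+ 6 / 5 * (ℤ.+ 34 / 35) ^ℚ n
  -- 5/17 · 34/35 = 2/7.
  l[2/7]^n≤ n = ≤*^⇒≤*^ {ι (l n)} {ℤ.+ 6 / 5} {ℤ.+ 5 / 17} {ℤ.+ 34 / 35} (ℚ.≤ᵇ⇒≤ _) n
    (l[5/17]^n≤ n)

-- Transfer of rational estimates to Cauchy reals.

module Reals where

  open import Data.Rational.Base using (_+_; _*_; _-_; _≤_; _<_; -_; ∣_∣; ½; _/_)
  open Defs using (ℝ; seq; cauchy; fromℚ; 1ℝ; 0ℝ; IsCauchy; Eventually; _⟶_; Summable;
    IsRadiusOfConvergence; LimSupRoot)
  open +-*-Solver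
  open Rational

  ∣x∣≤y : ∀ {x y} → x ≤ y → - x ≤ y → ∣ x ∣ ≤ y
  ∣x∣≤y {x} {y} x≤y -x≤y with ℚ.∣p∣≡p∨∣p∣≡-p x
  ... | inj₁ eq = subst (_≤ y) (sym eq) x≤y
  ... | inj₂ eq = subst (_≤ y) (sym eq) -x≤y

  x≤∣x∣ : ∀ x → x ≤ ∣ x ∣
  x≤∣x∣ x with ℚ.≤-total 0ℚ x
  ... | inj₁ 0≤x = ℚ.≤-reflexive (sym (ℚ.0≤p⇒∣p∣≡p 0≤x))
  ... | inj₂ x≤0 = ℚ.≤-trans x≤0 (ℚ.0≤∣p∣ x)

  ∣x-y∣≤⇒x≤y+ : ∀ {x y δ} → ∣ x - y ∣ ≤ δ → x ≤ y + δ
  ∣x-y∣≤⇒x≤y+ {x} {y} {δ} h = begin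
    x               ≡⟨ solve 2 (λ x y → x := y :+ (x :- y)) refl x y ⟩
    y + (x - y)     ≤⟨ ℚ.+-monoʳ-≤ y (ℚ.≤-trans (x≤∣x∣ (x - y)) h) ⟩
    y + δ           ∎
    where open ℚ.≤-Reasoning

  ∣x-y∣≤⇒y≤x+ : ∀ {x y δ} → ∣ x - y ∣ ≤ δ → y ≤ x + δ
  ∣x-y∣≤⇒y≤x+ {x} {y} {δ} h = ∣x-y∣≤⇒x≤y+ (subst (_≤ δ)
    (trans (sym (ℚ.∣-p∣≡∣p∣ (x - y)))
      (cong ∣_∣ (solve 2 (λ x y → :- (x :- y) := y :- x) refl x y))) h)

  x≤y+⇒x-y≤ : ∀ {x y δ} → x ≤ y + δ → x - y ≤ δ
  x≤y+⇒x-y≤ {x} {y} {δ} h = begin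
    x - y          ≤⟨ ℚ.+-monoˡ-≤ (- y) h ⟩
    (y + δ) - y    ≡⟨ solve 2 (λ y d → (y :+ d) :- y := d) refl y δ ⟩
    δ              ∎
    where open ℚ.≤-Reasoning

  x≤y+⇒∣x-y∣≤ : ∀ {x y δ} → x ≤ y + δ → y ≤ x + δ → ∣ x - y ∣ ≤ δ
  x≤y+⇒∣x-y∣≤ {x} {y} {δ} h h′ = ∣x∣≤y (x≤y+⇒x-y≤ h)
    (subst (_≤ δ) (solve 2 (λ x y → y :- x := :- (x :- y)) refl x y) (x≤y+⇒x-y≤ h′))

  half+half : ∀ ε → ε * ½ + ε * ½ ≡ ε
  half+half ε = trans (sym (ℚ.*-distribˡ-+ ε ½ ½)) (ℚ.*-identityʳ ε)

  infix 4 _≐_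

  -- Stricter than `_≃_`: the sequence is constant. Sums, products and powers preserve this
  -- termwise, so comparisons reduce to ℚ.
  _≐_ : ℝ → ℚ → Set
  x ≐ p = ∀ k → seq x k ≡ p

  ≐-< : ∀ {x y p r} → x ≐ p → y ≐ r → p < r → x Defs.< y
  ≐-< {x} {y} {p} {r} x≐p y≐r p<r = δ , 0<δ , 0 , λ k _ →
    subst₂ _<_ (cong (_+ δ) (sym (x≐p k))) (sym (y≐r k)) p+δ<r
    where
    -- Half of the gap, since `_<_` asks for a strict inequality even after the margin is added.
    δ = (r - p) * ½
    0<r-p : 0ℚ < r - p
    0<r-p = subst (_< r - p) (ℚ.+-inverseʳ p) (ℚ.+-monoˡ-< (- p) p<r)
    0<δ : 0ℚ < δ
    0<δ = 0<* 0<r-p (ℚ.positive⁻¹ ½)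
    open ℚ.≤-Reasoning
    p+δ<r : p + δ < r
    p+δ<r = begin-strict
      p + δ            ≡⟨ ℚ.+-identityʳ (p + δ) ⟨
      (p + δ) + 0ℚ     <⟨ ℚ.+-monoʳ-< (p + δ) 0<δ ⟩
      (p + δ) + δ      ≡⟨ ℚ.+-assoc p δ δ ⟩
      p + (δ + δ)      ≡⟨ cong (p +_) (half+half (r - p)) ⟩
      p + (r - p)      ≡⟨ solve 2 (λ p r → p :+ (r :- p) := r) refl p r ⟩
      r                ∎

  ≐-≤ : ∀ {x y p r} → x ≐ p → y ≐ r → p ≤ r → x Defs.≤ y
  ≐-≤ {p = p} {r} x≐p y≐r p≤r (δ , 0<δ , N , h) = ℚ.<-irrefl refl (begin-strict
    p         ≤⟨ p≤r ⟩
    r         ≤⟨ p≤p+r r (ℚ.<⇒≤ 0<δ) ⟩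
    r + δ     <⟨ subst₂ _<_ (cong (_+ δ) (y≐r N)) (x≐p N) (h N ℕ.≤-refl) ⟩
    p         ∎)
    where open ℚ.≤-Reasoning

  ≐-^ : ∀ {x p} → x ≐ p → ∀ n → x Defs.^ n ≐ p ^ℚ n
  ≐-^ x≐p zero    k = refl
  ≐-^ x≐p (suc n) k = cong₂ _*_ (x≐p k) (≐-^ x≐p n k)

  partialSumℚ : (ℕ → ℚ) → ℕ → ℚ
  partialSumℚ a zero    = 0ℚ
  partialSumℚ a (suc n) = partialSumℚ a n + a n

  ≐-partialSum : ∀ {x a} → (∀ n → x n ≐ a n) → ∀ n → Defs.partialSum x n ≐ partialSumℚ a n
  ≐-partialSum x≐a zero    k = refl
  ≐-partialSum x≐a (suc n) k = cong₂ _+_ (≐-partialSum x≐a n k) (x≐a n k)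

  -- A Cauchy sequence of rationals is itself a representative of its limit; the estimate needed is
  -- the Cauchy property at half of the margin δ.
  ≐-⟶ : ∀ {x s} → (∀ n → x n ≐ s n) → (cs : IsCauchy s) → x ⟶ Defs.mkℝ s cs
  ≐-⟶ {x} {s} x≐s cs ε (δ , 0<δ , N , h) =
    let 0<½δ   = 0<* 0<δ (ℚ.positive⁻¹ ½)
        N′ , h′ = cs (δ * ½) 0<½δ
    in N′ , λ n N′≤n → δ * ½ , 0<½δ , N ℕ.⊔ N′ , λ k p → begin-strict
      ∣ seq (x n) k - s k ∣ + δ * ½   ≡⟨ cong (λ t → ∣ t - s k ∣ + δ * ½) (x≐s n k) ⟩
      ∣ s n - s k ∣ + δ * ½           ≤⟨ ℚ.+-monoˡ-≤ (δ * ½)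
                                           (h′ n k N′≤n (ℕ.m⊔n≤o⇒n≤o N N′ p)) ⟩
      δ * ½ + δ * ½                   ≡⟨ half+half δ ⟩
      δ                               ≡⟨ ℚ.+-identityˡ δ ⟨
      0ℚ + δ                          <⟨ h k (ℕ.m⊔n≤o⇒m≤o N N′ p) ⟩
      seq ε k                         ∎
    where open ℚ.≤-Reasoning

  -- Convergence of series and the radius of convergence.

  monotone : ∀ {f : ℕ → ℚ} → (∀ n → f n ≤ f (suc n)) → ∀ {m n} → m ℕ.≤ n → f m ≤ f n
  monotone {f} step m≤n = go (ℕ.≤⇒≤′ m≤n)
    where
    go : ∀ {m n} → m ℕ.≤′ n → f m ≤ f n
    go (ℕ.≤′-reflexive refl) = ℚ.≤-refl
    go (ℕ.≤′-step p)         = ℚ.≤-trans (go p) (step _)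

  antitone : ∀ {f : ℕ → ℚ} → (∀ n → f (suc n) ≤ f n) → ∀ {m n} → m ℕ.≤ n → f n ≤ f m
  antitone {f} step m≤n = go (ℕ.≤⇒≤′ m≤n)
    where
    go : ∀ {m n} → m ℕ.≤′ n → f n ≤ f m
    go (ℕ.≤′-reflexive refl) = ℚ.≤-refl
    go (ℕ.≤′-step p)         = ℚ.≤-trans (step _) (go p)

  -- The tail g bounds the remainders: the partial sums P increase, P + g decreases.
  partialSum-cauchy : {a g : ℕ → ℚ} → (∀ n → 0ℚ ≤ a n) → (∀ n → 0ℚ ≤ g n) →
    (∀ n → a n + g (suc n) ≤ g n) → (∀ {ε} → 0ℚ < ε → ∃[ N ] g N ≤ ε) →
    IsCauchy (partialSumℚ a)
  partialSum-cauchy {a} {g} 0≤a 0≤g tail g→0 ε 0<ε =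
    let N , gN≤ε = g→0 0<ε
    in N , λ m n N≤m N≤n → ℚ.≤-trans (x≤y+⇒∣x-y∣≤ (close N≤m N≤n) (close N≤n N≤m)) gN≤ε
    where
    P = partialSumℚ a
    open ℚ.≤-Reasoning
    P-step : ∀ n → P n ≤ P (suc n)
    P-step n = p≤p+r (P n) (0≤a n)
    P+g-step : ∀ n → P (suc n) + g (suc n) ≤ P n + g n
    P+g-step n = subst (_≤ P n + g n) (sym (ℚ.+-assoc (P n) (a n) (g (suc n))))
      (ℚ.+-monoʳ-≤ (P n) (tail n))
    close : ∀ {N m n} → N ℕ.≤ m → N ℕ.≤ n → P m ≤ P n + g N
    close {N} {m} {n} N≤m N≤n = begin
      P m          ≤⟨ p≤p+r (P m) (0≤g m) ⟩
      P m + g m    ≤⟨ antitone {λ k → P k + g k} P+g-step N≤m ⟩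
      P N + g N    ≤⟨ ℚ.+-monoˡ-≤ (g N) (monotone {P} P-step N≤n) ⟩
      P n + g N    ∎

  ≤-<-connex : ∀ p r → p ≤ r ⊎ r < p
  ≤-<-connex p r with p ℚ.≤? r
  ... | yes p≤r = inj₁ p≤r
  ... | no  p≰r = inj₂ (ℚ.≰⇒> p≰r)

  -- Whether ρ ≤ q cannot be decided, but an approximation of ρ to within δ decides
  -- between q < ρ and ρ < r, and divergence beyond ρ excludes the latter.
  radius> : ∀ {a ρ q r δ} → IsRadiusOfConvergence a ρ → 0ℚ ≤ r → 0ℚ < δ →
            q + ((δ + δ) + (δ + δ)) < r →
            Summable (λ n → a n Defs.* fromℚ r Defs.^ n) → fromℚ q Defs.< ρ
  radius> {a} {ρ} {q} {r} {δ} (_ , diverges) 0≤r 0<δ q+4δ<r summable =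
    [ (λ ρN≤ → ⊥-elim (diverges (fromℚ r) (δ , 0<δ , N , below ρN≤) summable))
    , (λ <ρN → δ , 0<δ , N , above <ρN)
    ]′ (≤-<-connex (seq ρ N) (q + (δ + δ)))
    where
    N = proj₁ (cauchy ρ δ 0<δ)
    near : ∀ n → N ℕ.≤ n → ∣ seq ρ n - seq ρ N ∣ ≤ δ
    near n N≤n = proj₂ (cauchy ρ δ 0<δ) n N N≤n ℕ.≤-refl
    open ℚ.≤-Reasoning
    below : seq ρ N ≤ q + (δ + δ) → ∀ n → N ℕ.≤ n → seq ρ n + δ < ∣ r ∣
    below ρN≤ n N≤n = begin-strict
      seq ρ n + δ                ≤⟨ ℚ.+-monoˡ-≤ δ (∣x-y∣≤⇒x≤y+ {seq ρ n} (near n N≤n)) ⟩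
      (seq ρ N + δ) + δ          ≤⟨ ℚ.+-monoˡ-≤ δ (ℚ.+-monoˡ-≤ δ ρN≤) ⟩
      ((q + (δ + δ)) + δ) + δ    ≡⟨ solve 2 (λ q d → ((q :+ (d :+ d)) :+ d) :+ d :=
                                      q :+ ((d :+ d) :+ (d :+ d))) refl q δ ⟩
      q + ((δ + δ) + (δ + δ))    <⟨ q+4δ<r ⟩
      r                          ≡⟨ ℚ.0≤p⇒∣p∣≡p 0≤r ⟨
      ∣ r ∣                      ∎
    above : q + (δ + δ) < seq ρ N → ∀ n → N ℕ.≤ n → q + δ < seq ρ n
    above <ρN n N≤n = begin-strict
      q + δ                      ≡⟨ solve 2 (λ q d → q :+ d := (q :+ (d :+ d)) :- d) refl q δ ⟩
      (q + (δ + δ)) - δ          <⟨ ℚ.+-monoˡ-< (- δ) <ρN ⟩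
      seq ρ N - δ                ≤⟨ ℚ.+-monoˡ-≤ (- δ) (∣x-y∣≤⇒y≤x+ {seq ρ n} (near n N≤n)) ⟩
      (seq ρ n + δ) - δ          ≡⟨ solve 2 (λ x d → (x :+ d) :- d := x) refl (seq ρ n) δ ⟩
      seq ρ n                    ∎

  -- The remainders are bounded by B θⁿ, since A + B θ ≤ B means that B is at least the sum A / (1 -
  -- θ) of the majorant.
  geometric-cauchy : ∀ {a : ℕ → ℚ} {A θ h B} → (∀ n → 0ℚ ≤ a n) → 0ℚ ≤ θ → 0ℚ < h →
    θ * (1ℚ + h) ≤ 1ℚ → 0ℚ ≤ B → A + B * θ ≤ B → (∀ n → a n ≤ A * θ ^ℚ n) →
    ∀ B⁻¹ → 0ℚ < B⁻¹ → B * B⁻¹ ≡ 1ℚ → IsCauchy (partialSumℚ a)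
  geometric-cauchy {a} {A} {θ} {h} {B} 0≤a 0≤θ 0<h θ[1+h]≤1 0≤B A+Bθ≤B a≤ B⁻¹ 0<B⁻¹ BB⁻¹≡1 =
    partialSum-cauchy {a} {λ n → B * θ ^ℚ n} 0≤a (λ n → 0≤* 0≤B (0≤^ 0≤θ n)) tail vanish
    where
    open ℚ.≤-Reasoning
    tail : ∀ n → a n + B * (θ * θ ^ℚ n) ≤ B * θ ^ℚ n
    tail n = begin
      a n + B * (θ * θ ^ℚ n)            ≤⟨ ℚ.+-monoˡ-≤ (B * (θ * θ ^ℚ n)) (a≤ n) ⟩
      A * θ ^ℚ n + B * (θ * θ ^ℚ n)     ≡⟨ solve 4 (λ a b t s →
                                             a :* s :+ b :* (t :* s) := (a :+ b :* t) :* s)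
                                             refl A B θ (θ ^ℚ n) ⟩
      (A + B * θ) * θ ^ℚ n              ≤⟨ ℚ.*-monoʳ-≤-nonNeg (θ ^ℚ n)
                                             {{ℚ.nonNegative (0≤^ 0≤θ n)}} A+Bθ≤B ⟩
      B * θ ^ℚ n                        ∎
    scale : ∀ {N ε} → θ ^ℚ N < B⁻¹ * ε → B * θ ^ℚ N ≤ ε
    scale {N} {ε} h = begin
      B * θ ^ℚ N        ≤⟨ *-monoʳ 0≤B (ℚ.<⇒≤ h) ⟩
      B * (B⁻¹ * ε)     ≡⟨ ℚ.*-assoc B B⁻¹ ε ⟨
      B * B⁻¹ * ε       ≡⟨ cong (_* ε) BB⁻¹≡1 ⟩
      1ℚ * ε            ≡⟨ ℚ.*-identityˡ ε ⟩
      ε                 ∎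
    vanish : ∀ {ε} → 0ℚ < ε → ∃[ N ] B * θ ^ℚ N ≤ ε
    vanish 0<ε =
      let N , θ^n< = decay 0≤θ 0<h θ[1+h]≤1 (0<* 0<B⁻¹ 0<ε)
      in N , scale {N} (θ^n< N ℕ.≤-refl)

  l-term : ℕ → ℚ
  l-term n = ι (l n) * (ℤ.+ 2 / 7) ^ℚ n

  l-cauchy : IsCauchy (partialSumℚ l-term)
  -- 42 = 6/5 / (1 − 34/35) is the sum of the majorising geometric series.
  l-cauchy = geometric-cauchy {l-term} {ℤ.+ 6 / 5} {ℤ.+ 34 / 35} {ℤ.+ 1 / 34} {ℤ.+ 42 / 1}
    (λ n → 0≤* (0≤ι (l n)) (0≤^ (ℚ.≤ᵇ⇒≤ _) n)) (ℚ.≤ᵇ⇒≤ _)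
    (from-yes (0ℚ ℚ.<? ℤ.+ 1 / 34)) (ℚ.≤ᵇ⇒≤ _) (ℚ.≤ᵇ⇒≤ _) (ℚ.≤ᵇ⇒≤ _) Bounds.l[2/7]^n≤
    (ℤ.+ 1 / 42) (from-yes (0ℚ ℚ.<? ℤ.+ 1 / 42)) refl

  l-summable : Summable (λ n → Defs.fromℕ (l n) Defs.* fromℚ (ℤ.+ 2 / 7) Defs.^ n)
  l-summable = Defs.mkℝ (partialSumℚ l-term) l-cauchy , ≐-⟶
    {Defs.partialSum (λ n → Defs.fromℕ (l n) Defs.* fromℚ (ℤ.+ 2 / 7) Defs.^ n)}
    (≐-partialSum λ n k →
      cong (ι (l n) *_) (≐-^ {fromℚ (ℤ.+ 2 / 7)} (λ _ → refl) n k)) l-cauchy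

  -- The constants and the inequalities of the theorem.

  1ℝ^-≐ : ∀ n → 1ℝ Defs.^ n ≐ 1ℚ
  1ℝ^-≐ n k = trans (≐-^ {1ℝ} {1ℚ} (λ _ → refl) n k) (1^ n)

  limSupRoot-1 : LimSupRoot (λ _ → 1ℝ) 1ℝ
  limSupRoot-1 = (λ _ → 1ℝ) ,
    (λ n _ → ≐-≤ {0ℝ} {1ℝ} (λ _ → refl) (λ _ → refl) (ℚ.≤ᵇ⇒≤ _) ,
      λ ε 0<ε → 0 , λ k _ → subst (λ t → ∣ t - 1ℚ ∣ ≤ ε) (sym (1ℝ^-≐ n k)) (ℚ.<⇒≤ 0<ε)) ,
    (λ _ → 1ℝ) ,
    (λ _ → (λ _ → ≐-≤ {1ℝ} {1ℝ} (λ _ → refl) (λ _ → refl) ℚ.≤-refl) , λ _ 1≤b → 1≤b 0) ,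
    -- `∣ 1ℝ - 1ℝ ∣` computes to the constant sequence 0, so the hypothesis on ε is itself the
    -- estimate.
    λ _ 0<ε → 0 , λ _ _ → 0<ε

  -- The factor `1ℝ` is the value of θ and κ in the theorem.
  ≐-^*1 : ∀ {x p} → x ≐ p → ∀ n → x Defs.^ n Defs.* 1ℝ ≐ p ^ℚ n
  ≐-^*1 {x} x≐p n k = trans (ℚ.*-identityʳ (seq (x Defs.^ n) k)) (≐-^ {x} x≐p n k)

  ^*1<fromℕ : ∀ {x p} → x ≐ p → ∀ n m → p ^ℚ n < ι m → x Defs.^ n Defs.* 1ℝ Defs.< Defs.fromℕ m
  ^*1<fromℕ {x} x≐p n m = ≐-< {x Defs.^ n Defs.* 1ℝ} {Defs.fromℕ m} (≐-^*1 {x} x≐p n) (λ _ → refl)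

  fromℕ<^*1 : ∀ {x p} → x ≐ p → ∀ n m → ι m < p ^ℚ n → Defs.fromℕ m Defs.< x Defs.^ n Defs.* 1ℝ
  fromℕ<^*1 {x} x≐p n m = ≐-< {Defs.fromℕ m} {x Defs.^ n Defs.* 1ℝ} (λ _ → refl) (≐-^*1 {x} x≐p n)

  0<ρ-over : 0ℝ Defs.< fromℚ (ℤ.+ 1 / 7)
  0<ρ-over = ≐-< {0ℝ} {fromℚ (ℤ.+ 1 / 7)} (λ _ → refl) (λ _ → refl)
    (from-yes (0ℚ ℚ.<? ℤ.+ 1 / 7))

  0<ρ-under : 0ℝ Defs.< fromℚ (ℤ.+ 7 / 25)
  0<ρ-under = ≐-< {0ℝ} {fromℚ (ℤ.+ 7 / 25)} (λ _ → refl) (λ _ → refl)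
    (from-yes (0ℚ ℚ.<? ℤ.+ 7 / 25))

  ρ-over<ρ-under : fromℚ (ℤ.+ 1 / 7) Defs.< fromℚ (ℤ.+ 7 / 25)
  ρ-over<ρ-under = ≐-< {fromℚ (ℤ.+ 1 / 7)} {fromℚ (ℤ.+ 7 / 25)} (λ _ → refl) (λ _ → refl)
    (from-yes (ℤ.+ 1 / 7 ℚ.<? ℤ.+ 7 / 25))

  -- The gap 2/7 - 7/25 is 1/175 = 5/875, which leaves room for four margins of 1/875.
  7/25+4δ<2/7 : ℤ.+ 7 / 25 + ((ℤ.+ 1 / 875 + ℤ.+ 1 / 875) + (ℤ.+ 1 / 875 + ℤ.+ 1 / 875)) < ℤ.+ 2 / 7
  7/25+4δ<2/7 = from-yes (ℤ.+ 7 / 25 + ((ℤ.+ 1 / 875 + ℤ.+ 1 / 875) + (ℤ.+ 1 / 875 + ℤ.+ 1 / 875)) ℚ.<? ℤ.+ 2 / 7)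

  ρ-under<ρ : ∀ {ρ} → IsRadiusOfConvergence (λ n → Defs.fromℕ (l n)) ρ →
              fromℚ (ℤ.+ 7 / 25) Defs.< ρ
  ρ-under<ρ {ρ} radius = radius> {λ n → Defs.fromℕ (l n)} {ρ} {ℤ.+ 7 / 25} {ℤ.+ 2 / 7} {ℤ.+ 1 / 875} radius
    (ℚ.≤ᵇ⇒≤ _) (from-yes (0ℚ ℚ.<? ℤ.+ 1 / 875)) 7/25+4δ<2/7
    l-summable

  inv-under^n<c : Eventually (λ n →
    Defs.inv (fromℚ (ℤ.+ 7 / 25)) 0<ρ-under Defs.^ n Defs.* 1ℝ Defs.< Defs.fromℕ (c 0 n))
  inv-under^n<c = proj₁ Bounds.[25/7]^n<c , λ n N≤n →
    -- `inv` truncates below at the margin in `0<ρ-under`, which is 7/50; the maximum with 7/25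
    -- computes to 7/25, and its inverse to 25/7.
    ^*1<fromℕ {Defs.inv (fromℚ (ℤ.+ 7 / 25)) 0<ρ-under} {ℤ.+ 25 / 7} (λ _ → refl) n (c 0 n)
      (proj₂ Bounds.[25/7]^n<c n N≤n)

  c<inv-over^n : ∀ n →
    Defs.fromℕ (c 0 n) Defs.< Defs.inv (fromℚ (ℤ.+ 1 / 7)) 0<ρ-over Defs.^ n Defs.* 1ℝ
  c<inv-over^n n =
    fromℕ<^*1 {Defs.inv (fromℚ (ℤ.+ 1 / 7)) 0<ρ-over} {ℤ.+ 7 / 1} (λ _ → refl) n (c 0 n)
      (Bounds.c<7^n n)

open import Defs

theorem8p3 : (ρ-L∞ : ℝ) → IsRadiusOfConvergence (λ n → fromℕ (l n)) ρ-L∞ →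
    Σ ℝ λ ρ-over → Σ ℝ λ ρ-under →
    Σ (0ℝ < ρ-over) λ 0<ρ-over → Σ (0ℝ < ρ-under) λ 0<ρ-under →
    ρ-over < ρ-under × ρ-under < ρ-L∞ ×
    Σ (ℕ → ℝ) λ θ → Σ (ℕ → ℝ) λ κ →
    LimSupRoot θ 1ℝ × LimSupRoot κ 1ℝ ×
    Eventually (λ n →
    inv ρ-under 0<ρ-under ^ n * θ n < fromℕ (c 0 n) ×
    fromℕ (c 0 n) < inv ρ-over 0<ρ-over ^ n * κ n)
theorem8p3 ρ-L∞ radius =
  fromℚ (ℤ.+ 1 ℚ./ 7) , fromℚ (ℤ.+ 7 ℚ./ 25) , Reals.0<ρ-over , Reals.0<ρ-under ,
  Reals.ρ-over<ρ-under , Reals.ρ-under<ρ {ρ-L∞} radius , (λ _ → 1ℝ) , (λ _ → 1ℝ) ,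
  Reals.limSupRoot-1 , Reals.limSupRoot-1 ,
  -- The threshold comes from the lower bound; the upper bound holds for every n.
  proj₁ Reals.inv-under^n<c , λ n N≤n →
    proj₂ Reals.inv-under^n<c n N≤n , Reals.c<inv-over^n n
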